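{- Let $b$ be a graph over $(X,m)$, let $p\in[1,\infty)$ and let $d$ be a pseudo metric on $X$ such that all distance balls $B^{(d)}_r(o)$ ($o\in X$, $r\ge0$) are finite sets and such that $$\sum_{y\in X}b(x,y)\,d(x,y)^{p}\leq m(x)\qquad\text{for all }x\in X.$$ Then $$\lambda^{(0)}_{p}\leq\frac{\mu^{p}}{2p^{p}},$$ where $\mu$ is the exponential volume growth of $X$ with respect to $d$.
   Context: Setting: $X$ is a nonempty countable (finite or infinite) set, $C(X)$ is the space of real-valued functions on $X$ and $C_c(X)$ the subspace of finitely supported functions. A graph $b$ over $(X,m)$ consists of a symmetric function $b:X\times X\to[0,\infty)$ with $b(x,x)=0$ and $\sum_{y\in X}b(x,y)<\infty$ for all $x\in X$, and a function $m:X\to(0,\infty)$, extended to a measure on subsets by $m(W)=\sum_{x\in W}m(x)$. $\|f\|_{m,p}=\bigl(\sum_{x\in X}|f(x)|^p m(x)\bigr)^{1/p}$. Energy: $\mathcal{E}_p(f)=\frac12\sum_{x,y\in X}b(x,y)|f(x)-f(y)|^p\in[0,\infty]$ for $f\in C(X)$, and $$\lambda^{(0)}_p=\inf_{0\neq\varphi\in C_c(X)}\frac{\mathcal{E}_p(\varphi)}{\|\varphi\|_{m,p}^p}.$$ A pseudo metric is a symmetric function $d:X\times X\to[0,\infty)$ with $d(x,x)=0$ satisfying the triangle inequality. $B^{(d)}_r(o)=\{x\in X: d(o,x)\le r\}$ is the distance ball with center $o$ and radius $r$. The exponential volume growth is $$\mu=\liminf_{r\to\infty}\ \inf_{o\in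 X}\ \frac1r\log\frac{m(B^{(d)}_r(o))}{m(B^{(d)}_1(o))}\in[0,\infty]$$ (if $\mu=\infty$ the right-hand side of the inequality is read as $+\infty$). -}

module Defs where

open import Algebra.Bundles using (CommutativeRing; Semiring)
import Algebra.Construct.NaturalChoice.Max as Max
import Algebra.Definitions.RawSemiring as RawSemiring
open import Axiom.ExcludedMiddle using (ExcludedMiddle)
open import Data.List.Base using (List; map; foldr)
open import Data.List.Membership.Propositional using (_∈_)
open import Data.List.Relation.Unary.All using (All)
open import Data.List.Relation.Unary.Unique.Propositional using (Unique)
open import Data.Nat.Base using (ℕ; suc)
open import Data.Product.Base using (Σ-syntax; ∃-syntax; _×_; _,_; proj₁)
open import Function.Metric.Definitions using (Symmetric; TriangleInequality)
open import Function.Metric.Structures using (IsPreMetric)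
open import Level using (0ℓ) renaming (suc to lsuc)
open import Relation.Binary.Bundles using (TotalOrder)
open import Relation.Binary.Core using (Rel)
import Relation.Binary.Construct.Add.Extrema.NonStrict as NonStrict
import Relation.Binary.Construct.Add.Extrema.Strict as Strict
import Relation.Binary.Construct.NonStrictToStrict as NonStrictToStrict
open import Relation.Binary.PropositionalEquality.Core using (_≡_)
open import Relation.Binary.Structures using (IsTotalOrder)
open import Relation.Nullary.Construct.Add.Extrema using (_±; ⊥±; [_]; ⊤±)
open import Relation.Nullary.Decidable.Core using (yes; no)
open import Relation.Nullary.Negation.Core using (¬_)
open import Relation.Unary using (Pred; U)

IsUpperBound IsLub : {A : Set} → Rel A 0ℓ → Pred A 0ℓ → Pred A 0ℓ
IsUpperBound _≤_ P u = ∀ x → P x → x ≤ u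
IsLub _≤_ P s = IsUpperBound _≤_ P s × (∀ u → IsUpperBound _≤_ P u → s ≤ u)

-- The real numbers, up to isomorphism: a Dedekind-complete ordered field.
-- Granted excluded middle, cuts ℚ → Bool under pointwise equality are a model.
-- Nothing is assumed about 0# ⁻¹.
record CompleteOrderedField : Set (lsuc 0ℓ) where
  infix  8 _⁻¹
  infixl 7 _/_
  infix  4 _≤_
  field
    commutativeRing : CommutativeRing 0ℓ 0ℓ

  open CommutativeRing commutativeRing public

  field
    _⁻¹          : Carrier → Carrier
    0≉1          : ¬ 0# ≈ 1#
    ⁻¹-inverseʳ  : ∀ x → ¬ x ≈ 0# → x * x ⁻¹ ≈ 1#
    _≤_          : Rel Carrier 0ℓ
    isTotalOrder : IsTotalOrder _≈_ _≤_
    +-monoˡ-≤    : ∀ {x y} z → x ≤ y → x + z ≤ y + z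
    *-nonNeg     : ∀ {x y} → 0# ≤ x → 0# ≤ y → 0# ≤ x * y
    complete     : (P : Pred Carrier 0ℓ) → (∃[ x ] P x) →
                   (∃[ u ] IsUpperBound _≤_ P u) → ∃[ s ] IsLub _≤_ P s

  totalOrder : TotalOrder 0ℓ 0ℓ 0ℓ
  totalOrder = record { isTotalOrder = isTotalOrder }

  open NonStrictToStrict _≈_ _≤_ public using (_<_)
  open Max totalOrder public using (_⊔_)

  _/_ : Carrier → Carrier → Carrier
  x / y = x * y ⁻¹

  ∣_∣ : Carrier → Carrier
  ∣ x ∣ = x ⊔ (- x)

-- Classical real analysis: excluded middle is what makes suprema, and with them
-- exp, log and real powers, total functions.
module Analysis (em : ExcludedMiddle 0ℓ) (R : CompleteOrderedField) where

  open CompleteOrderedField R public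
  open RawSemiring (Semiring.rawSemiring semiring) using () renaming (_×_ to _·_; _^_ to _^ⁿ_)

  ℝ : Set
  ℝ = Carrier

  ℝ̄ : Set
  ℝ̄ = ℝ ±

  open NonStrict _≤_ public using (_≤±_)
  open Strict _<_ public using (_<±_)

  -- The completed field is recovered with value 0 at the infinities; this is
  -- applied only to quantities that are finite.
  real : ℝ̄ → ℝ
  real ⊥±    = 0#
  real [ x ] = x
  real ⊤±    = 0#

  neg : ℝ̄ → ℝ̄
  neg ⊥±    = ⊤±
  neg [ x ] = [ - x ]
  neg ⊤±    = ⊥±

  -- Division of an extended real by a real, used for positive divisors only.
  infixl 7 _÷_
  _÷_ : ℝ̄ → ℝ → ℝ̄
  ⊥±    ÷ c = ⊥±
  [ x ] ÷ c = [ x / c ]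
  ⊤±    ÷ c = ⊤±

  -- Suprema in the extended reals are computed from the set of reals lying
  -- below some member of the family.
  Below : {I : Set} → (I → ℝ̄) → Pred ℝ 0ℓ
  Below f x = ∃[ i ] ([ x ] ≤± f i)

  ⨆ : {I : Set} → (I → ℝ̄) → ℝ̄
  ⨆ f with em {∃[ x ] Below f x} | em {∃[ u ] IsUpperBound _≤_ (Below f) u}
  ... | no  _        | _           = ⊥±
  ... | yes _        | no  _       = ⊤±
  ... | yes nonempty | yes bounded = [ proj₁ (complete (Below f) nonempty bounded) ]

  ⨅ : {I : Set} → (I → ℝ̄) → ℝ̄
  ⨅ f = neg (⨆ (λ i → neg (f i)))

  liminf∞ : (ℝ → ℝ̄) → ℝ̄
  liminf∞ g = ⨆ λ s → ⨅ {∃[ r ] s ≤ r} λ (r , _) → g r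

  -- Sums of nonnegative terms over a subset: the supremum of the sums over
  -- finite sets, which are presented as duplicate-free lists.
  ∑∈ : {A : Set} → Pred A 0ℓ → (A → ℝ) → ℝ̄
  ∑∈ {A} W f = ⨆ {Σ[ xs ∈ List A ] (Unique xs × All W xs)}
                 λ (xs , _) → [ foldr _+_ 0# (map f xs) ]

  ∑ : {A : Set} → (A → ℝ) → ℝ̄
  ∑ = ∑∈ U

  -- (1 + x/n)ⁿ with n ≥ 1 is nondecreasing in n as long as 1 + x/n > 0, so that
  -- its limit exp x is a supremum.
  exp : ℝ → ℝ
  exp x = real (⨆ {∃[ n ] 0# < 1# + x / (suc n · 1#)}
                  λ (n , _) → [ (1# + x / (suc n · 1#)) ^ⁿ suc n ])

  -- The inverse of exp on the positive reals; meaningless elsewhere.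
  log : ℝ → ℝ
  log y = real (⨆ {∃[ x ] exp x ≤ y} λ (x , _) → [ x ])

  -- Real powers of nonnegative reals, with positive exponent at base 0.
  infixr 8 _^_
  _^_ : ℝ → ℝ → ℝ
  x ^ p with em {0# < x}
  ... | yes _ = exp (p * log x)
  ... | no  _ = 0#

  -- Powers of elements of [0,∞] with positive exponent.
  infixr 8 _^±_
  _^±_ : ℝ̄ → ℝ → ℝ̄
  ⊥±    ^± p = ⊥±
  [ x ] ^± p = [ x ^ p ]
  ⊤±    ^± p = ⊤±

  2# : ℝ
  2# = 1# + 1#

  IsFinite : {A : Set} → Pred A 0ℓ → Set
  IsFinite {A} W = Σ[ xs ∈ List A ] (∀ x → W x → x ∈ xs)

  record IsPseudoMetric {X : Set} (d : X → X → ℝ) : Set where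
    field
      isPreMetric : IsPreMetric _≡_ _≈_ _≤_ 0# d
      sym         : Symmetric _≈_ d
      triangle    : TriangleInequality _≤_ _+_ d

  Ball : {X : Set} → (X → X → ℝ) → X → ℝ → Pred X 0ℓ
  Ball d o r x = d o x ≤ r

  -- A graph b over (X , m).
  record Graph (X : Set) : Set where
    field
      b            : X → X → ℝ
      b-nonNeg     : ∀ x y → 0# ≤ b x y
      b-sym        : ∀ x y → b x y ≈ b y x
      b-diag       : ∀ x → b x x ≈ 0#
      b-summable   : ∀ x → ∑ (b x) <± ⊤±
      m            : X → ℝ
      m-pos        : ∀ x → 0# < m x

    measure : Pred X 0ℓ → ℝ̄
    measure W = ∑∈ W m

    norm : ℝ → (X → ℝ) → ℝ̄
    norm p f = ∑ (λ x → ∣ f x ∣ ^ p * m x) ^± (1# / p)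

    energy : ℝ → (X → ℝ) → ℝ̄
    energy p f = ∑ (λ ((x , y) : X × X) → b x y * ∣ f x - f y ∣ ^ p) ÷ 2#

    FinitelySupported NonZero : Pred (X → ℝ) 0ℓ
    FinitelySupported φ = IsFinite (λ x → ¬ φ x ≈ 0#)
    NonZero φ           = ¬ (∀ x → φ x ≈ 0#)

    λ⁽⁰⁾ : ℝ → ℝ̄
    λ⁽⁰⁾ p = ⨅ {Σ[ φ ∈ (X → ℝ) ] (FinitelySupported φ × NonZero φ)}
               λ (φ , _) → energy p φ ÷ real (norm p φ) ^ p

    -- The values at r ≤ 0 do not affect the limit inferior.
    volumeGrowth : (X → X → ℝ) → ℝ̄
    volumeGrowth d = liminf∞ λ r → ⨅ λ (o : X) →
      [ 1# / r * log (real (measure (Ball d o r)) / real (measure (Ball d o 1#))) ]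

{-# OPTIONS --safe #-}

-- Let B be the ball of radius r about o, and take φ = exp (a (r - d o ·)⁺) - 1 as test
-- function.  From tanh t ≤ t and the convexity of t ↦ tᵖ,
--   2 |eˢ - eᵗ|ᵖ ≤ (eᵖˢ + eᵖᵗ) |s - t|ᵖ,
-- so the condition on d yields 2 ℰ(φ) ≤ aᵖ ∑_B ((φ + 1)ᵖ + 1) m.  Up to a factor close to 1
-- and a multiple of m(B), the right-hand side is aᵖ ‖φ‖ᵖ, while
-- ‖φ‖ᵖ ≥ (exp (a (r - 1)) - 1)ᵖ m(B₁).  If a p exceeds the volume growth, r and o can be
-- chosen with r large and m(B) small against exp (p a r) m(B₁), hence 2 λ ≤ cᵖ for every c > a.

module Submission where

open import Algebra.Bundles using (CommutativeRing; RawRing; Semiring)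
import Algebra.Construct.NaturalChoice.Max as Max
import Algebra.Definitions.RawSemiring as RawSemiring
import Algebra.Properties.CommutativeSemiring.Exp as CommutativeExp
import Algebra.Properties.Semiring.Exp as Exp
import Algebra.Properties.Semiring.Mult as Mult
open import Algebra.Solver.Ring.AlmostCommutativeRing using (_-Raw-AlmostCommutative⟶_; fromCommutativeRing)
open import Axiom.ExcludedMiddle using (ExcludedMiddle)
open import Data.Integer.Base as ℤ using (ℤ; +_; -[1+_]; _⊖_)
import Data.Integer.Properties as ℤ
open import Data.List.Base using (List; []; _∷_; map; foldr; filter; deduplicate)
open import Data.List.Membership.Propositional using (_∈_)
open import Data.List.Membership.Propositional.Properties using (∈-filter⁺; ∈-filter⁻; ∈-deduplicate⁺; ∈-deduplicate⁻)
open import Data.List.Relation.Unary.All as All using (All; []; _∷_)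
import Data.List.Relation.Unary.All.Properties as All
open import Data.List.Relation.Unary.AllPairs using ([]; _∷_)
open import Data.List.Relation.Unary.Any using (here; there)
import Data.List.Relation.Unary.Unique.DecPropositional.Properties as UniqueDec
open import Data.List.Relation.Unary.Unique.Propositional using (Unique)
import Data.List.Relation.Unary.Unique.Propositional.Properties as Unique
import Data.Maybe.Base as Maybe
open import Data.Nat.Base as ℕ using (ℕ; zero; suc)
import Data.Nat.Properties as ℕ
open import Data.Product.Base using (Σ-syntax; ∃-syntax; _×_; _,_; proj₁; proj₂; swap)
open import Data.Sum.Base as Sum using (_⊎_; inj₁; inj₂; [_,_]′)
open import Data.Unit.Base using (⊤; tt)
open import Function.Base using (_∘_)
open import Function.Bundles using (_↣_)
open import Function.Metric.Structures using (IsPreMetric)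
open import Level using (0ℓ)
open import Relation.Binary.Bundles using (TotalOrder)
import Relation.Binary.Construct.Add.Extrema.NonStrict as NonStrict
import Relation.Binary.Construct.Add.Supremum.NonStrict as Supremum
open import Relation.Binary.Definitions using (DecidableEquality)
import Relation.Binary.Properties.TotalOrder as TotalOrderProperties
open import Relation.Binary.PropositionalEquality.Core as ≡ using (_≡_)
open import Relation.Nullary.Construct.Add.Extrema using (⊥±; [_]; ⊤±)
open import Relation.Nullary.Decidable.Core using (Dec; yes; no; ¬?; dec⇒maybe)
open import Relation.Nullary.Negation.Core using (¬_; contradiction)
open import Relation.Unary using (Pred; U)
open import Defs

-- Subtracting 1 makes φ finitely supported, but differences of φ are governed by φ + 1 and not by
-- φ. Intermediate rates a < a′ < c pay for this. Where φ + 1 is large, a (φ + 1) ≤ a′ φ; the other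
-- points of the ball contribute at most a constant times m(B), which is absorbed into (cᵖ - a′ᵖ)
-- ‖φ‖ᵖ. The absorption compares exp (ν r) m(B₁), a bound for m(B), with the size exp (p a r) m(B₁)
-- of ‖φ‖ᵖ, so it needs ν < p a: this is the origin of pᵖ in the denominator. The exponential is
-- given only as a supremum of powers (1 + x/n)ⁿ. Its properties are therefore inequalities between
-- such powers carried over to the supremum, and the tangent inequality 1 + x ≤ exp x takes the
-- place of continuity and derivatives.

-- Ring identities with integer coefficients.

module IntegerCoefficients {c ℓ} (A : CommutativeRing c ℓ) where

  open CommutativeRing A
  open import Algebra.Properties.Ring ring using (-‿distribˡ-*; -‿distribʳ-*)
  open import Algebra.Properties.AbelianGroup +-abelianGroup using (⁻¹-∙-comm; ε⁻¹≈ε; ⁻¹-involutive)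
  import Algebra.Properties.Semiring.Mult.TCOptimised semiring as M
  import Algebra.Properties.Monoid.Mult.TCOptimised +-monoid as MM
  open import Relation.Binary.Reasoning.Setoid setoid

  private
    -- With the optimised multiple the integer constants 0, 1 and 2 evaluate to `0#`, `1#` and
    -- `1# + 1#` by computation, so the solved equations fit the goals without conversion.
    ⟦_⟧ℕ : ℕ → Carrier
    ⟦ n ⟧ℕ = n MM.× 1#

    ⟦_⟧ℤ : ℤ → Carrier
    ⟦ + n ⟧ℤ      = ⟦ n ⟧ℕ
    ⟦ -[1+ n ] ⟧ℤ = - ⟦ suc n ⟧ℕ

    cancel-+ : ∀ a b c → (a + b) - (a + c) ≈ b - c
    cancel-+ a b c = begin
      (a + b) - (a + c)       ≈⟨ +-cong (+-comm a b) (sym (⁻¹-∙-comm a c)) ⟩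
      (b + a) + (- a + - c)   ≈⟨ +-assoc b a _ ⟩
      b + (a + (- a + - c))   ≈⟨ +-congˡ (+-assoc a (- a) _) ⟨
      b + ((a + - a) + - c)   ≈⟨ +-congˡ (+-congʳ (-‿inverseʳ a)) ⟩
      b + (0# + - c)          ≈⟨ +-congˡ (+-identityˡ _) ⟩
      b - c                   ∎

    ⊖-homo : ∀ m n → ⟦ m ⊖ n ⟧ℤ ≈ ⟦ m ⟧ℕ - ⟦ n ⟧ℕ
    ⊖-homo m       zero    = sym (trans (+-congˡ ε⁻¹≈ε) (+-identityʳ _))
    ⊖-homo zero    (suc n) = sym (+-identityˡ _)
    ⊖-homo (suc m) (suc n) = begin
      ⟦ suc m ⊖ suc n ⟧ℤ              ≡⟨ ≡.cong ⟦_⟧ℤ (ℤ.[1+m]⊖[1+n]≡m⊖n m n) ⟩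
      ⟦ m ⊖ n ⟧ℤ                      ≈⟨ ⊖-homo m n ⟩
      ⟦ m ⟧ℕ - ⟦ n ⟧ℕ                 ≈⟨ cancel-+ 1# _ _ ⟨
      (1# + ⟦ m ⟧ℕ) - (1# + ⟦ n ⟧ℕ)   ≈⟨ +-cong (MM.1+× m 1#) (-‿cong (MM.1+× n 1#)) ⟨
      ⟦ suc m ⟧ℕ - ⟦ suc n ⟧ℕ         ∎

    +-homo : ∀ i j → ⟦ i ℤ.+ j ⟧ℤ ≈ ⟦ i ⟧ℤ + ⟦ j ⟧ℤ
    +-homo (+ m)    (+ n)    = MM.×-homo-+ 1# m n
    +-homo (+ m)    -[1+ n ] = ⊖-homo m (suc n)
    +-homo -[1+ m ] (+ n)    = trans (⊖-homo n (suc m)) (+-comm _ _)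
    +-homo -[1+ m ] -[1+ n ] = begin
      - ⟦ suc (suc (m ℕ.+ n)) ⟧ℕ        ≡⟨ ≡.cong (λ k → - ⟦ k ⟧ℕ) (ℕ.+-suc (suc m) n) ⟨
      - ⟦ suc m ℕ.+ suc n ⟧ℕ            ≈⟨ -‿cong (MM.×-homo-+ 1# (suc m) (suc n)) ⟩
      - (⟦ suc m ⟧ℕ + ⟦ suc n ⟧ℕ)       ≈⟨ ⁻¹-∙-comm _ _ ⟨
      - ⟦ suc m ⟧ℕ - ⟦ suc n ⟧ℕ         ∎

    -‿homo : ∀ i → ⟦ ℤ.- i ⟧ℤ ≈ - ⟦ i ⟧ℤ
    -‿homo (+ zero)  = sym ε⁻¹≈ε
    -‿homo (+ suc n) = refl
    -‿homo -[1+ n ]  = sym (⁻¹-involutive _)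

    *-homo⁺ : ∀ m n → ⟦ + m ℤ.* + n ⟧ℤ ≈ ⟦ + m ⟧ℤ * ⟦ + n ⟧ℤ
    *-homo⁺ m n = begin
      ⟦ + m ℤ.* + n ⟧ℤ  ≡⟨ ≡.cong ⟦_⟧ℤ (ℤ.pos-* m n) ⟨
      ⟦ m ℕ.* n ⟧ℕ      ≈⟨ M.×1-homo-* m n ⟩
      ⟦ m ⟧ℕ * ⟦ n ⟧ℕ   ∎

    *-homo : ∀ i j → ⟦ i ℤ.* j ⟧ℤ ≈ ⟦ i ⟧ℤ * ⟦ j ⟧ℤ
    *-homo (+ m)    (+ n)    = *-homo⁺ m n
    *-homo (+ m)    -[1+ n ] = begin
      ⟦ + m ℤ.* -[1+ n ] ⟧ℤ          ≡⟨ ≡.cong ⟦_⟧ℤ (ℤ.neg-distribʳ-* (+ m) (+ suc n)) ⟨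
      ⟦ ℤ.- (+ m ℤ.* + suc n) ⟧ℤ     ≈⟨ -‿homo (+ m ℤ.* + suc n) ⟩
      - ⟦ + m ℤ.* + suc n ⟧ℤ         ≈⟨ -‿cong (*-homo⁺ m (suc n)) ⟩
      - (⟦ m ⟧ℕ * ⟦ suc n ⟧ℕ)        ≈⟨ -‿distribʳ-* _ _ ⟩
      ⟦ m ⟧ℕ * - ⟦ suc n ⟧ℕ          ∎
    *-homo -[1+ m ] (+ n)    = begin
      ⟦ -[1+ m ] ℤ.* + n ⟧ℤ          ≡⟨ ≡.cong ⟦_⟧ℤ (ℤ.neg-distribˡ-* (+ suc m) (+ n)) ⟨
      ⟦ ℤ.- (+ suc m ℤ.* + n) ⟧ℤ     ≈⟨ -‿homo (+ suc m ℤ.* + n) ⟩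
      - ⟦ + suc m ℤ.* + n ⟧ℤ         ≈⟨ -‿cong (*-homo⁺ (suc m) n) ⟩
      - (⟦ suc m ⟧ℕ * ⟦ n ⟧ℕ)        ≈⟨ -‿distribˡ-* _ _ ⟩
      - ⟦ suc m ⟧ℕ * ⟦ n ⟧ℕ          ∎
    *-homo -[1+ m ] -[1+ n ] = begin
      ⟦ + (suc m ℕ.* suc n) ⟧ℤ       ≈⟨ M.×1-homo-* (suc m) (suc n) ⟩
      ⟦ suc m ⟧ℕ * ⟦ suc n ⟧ℕ        ≈⟨ ⁻¹-involutive _ ⟨
      - - (⟦ suc m ⟧ℕ * ⟦ suc n ⟧ℕ)  ≈⟨ -‿cong (-‿distribˡ-* _ _) ⟩
      - (- ⟦ suc m ⟧ℕ * ⟦ suc n ⟧ℕ)  ≈⟨ -‿distribʳ-* _ _ ⟩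
      - ⟦ suc m ⟧ℕ * - ⟦ suc n ⟧ℕ    ∎

    ℤ-rawRing : RawRing _ _
    ℤ-rawRing = record { _≈_ = ≡._≡_ ; _+_ = ℤ._+_ ; _*_ = ℤ._*_ ; -_ = ℤ.-_ ; 0# = + 0 ; 1# = + 1 }

    morphism : ℤ-rawRing -Raw-AlmostCommutative⟶ fromCommutativeRing A
    morphism = record
      { ⟦_⟧ = ⟦_⟧ℤ ; +-homo = +-homo ; *-homo = *-homo ; -‿homo = -‿homo
      ; 0-homo = refl ; 1-homo = refl }

    -- The solver has to compare coefficients by computation, which integers allow and elements of
    -- `A` need not. The test may be one-sided: distinct integers can have equal images.
    _coeff≟_ : ∀ i j → _
    i coeff≟ j = Maybe.map (λ i≡j → reflexive (≡.cong ⟦_⟧ℤ i≡j)) (dec⇒maybe (i ℤ.≟ j))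

  open import Algebra.Solver.Ring ℤ-rawRing (fromCommutativeRing A) morphism _coeff≟_ public
    using (solve; _:=_; _:+_; _:*_; _:-_; :-_; con)

module RealAnalysis (em : ExcludedMiddle 0ℓ) (R : CompleteOrderedField) where

  open Analysis em R
  open IntegerCoefficients commutativeRing
  open TotalOrderProperties totalOrder
    using (≰⇒>; <⇒≱; <-trans; <-respʳ-≈; <-respˡ-≈)
  open TotalOrder totalOrder
    using (total) renaming (refl to ≤-refl; reflexive to ≤-reflexive; trans to ≤-trans; antisym to ≤-antisym)

  open Max totalOrder using (x≤x⊔y; x≤y⊔x; ⊔-lub; ⊔-sel; ⊔-cong)

  open import Relation.Binary.Reasoning.PartialOrder (TotalOrder.poset totalOrder)

  -- Ordered-field arithmetic and the Archimedean property.

  <⇒≤ : ∀ {x y} → x < y → x ≤ y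
  <⇒≤ = proj₁

  ≤-<-trans : ∀ {x y z} → x ≤ y → y < z → x < z
  ≤-<-trans {x} {y} {z} p q = begin-strict x ≤⟨ p ⟩ y <⟨ q ⟩ z ∎

  <-≤-trans : ∀ {x y z} → x < y → y ≤ z → x < z
  <-≤-trans {x} {y} {z} p q = begin-strict x <⟨ p ⟩ y ≤⟨ q ⟩ z ∎

  <-total : ∀ x y → x < y ⊎ y ≤ x
  <-total x y with em {y ≤ x}
  ... | yes p = inj₂ p
  ... | no ¬p = inj₁ (≰⇒> ¬p)

  ≤-by-contra : ∀ {x y} → ¬ (y < x) → x ≤ y
  ≤-by-contra {x} {y} h = [ (λ y<x → contradiction y<x h) , (λ p → p) ]′ (<-total y x)

  -- Inequalities are certified by an expression e, evidently nonnegative, which the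
  -- ring solver identifies with the difference of the two sides.
  ≤-cert : ∀ {x y} e → y - x ≈ e → 0# ≤ e → x ≤ y
  ≤-cert {x} {y} e eq 0≤e = begin
    x           ≈⟨ +-identityˡ x ⟨
    0# + x      ≤⟨ +-monoˡ-≤ x 0≤e ⟩
    e + x       ≈⟨ +-congʳ eq ⟨
    y - x + x   ≈⟨ solve 2 (λ x y → y :- x :+ x := y) refl x y ⟩
    y           ∎

  0≤y-x : ∀ {x y} → x ≤ y → 0# ≤ y - x
  0≤y-x {x} {y} p = begin
    0#      ≈⟨ -‿inverseʳ x ⟨
    x - x   ≤⟨ +-monoˡ-≤ (- x) p ⟩
    y - x   ∎

  y-x≈0⇒x≈y : ∀ {x y} → y - x ≈ 0# → x ≈ y
  y-x≈0⇒x≈y {x} {y} eq = begin-equality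
    x           ≈⟨ +-identityˡ x ⟨
    0# + x      ≈⟨ +-congʳ eq ⟨
    y - x + x   ≈⟨ solve 2 (λ x y → y :- x :+ x := y) refl x y ⟩
    y           ∎

  <-cert : ∀ {x y} e → y - x ≈ e → 0# < e → x < y
  <-cert {x} {y} e eq (0≤e , 0≉e) = ≤-cert e eq 0≤e ,
    λ x≈y → 0≉e (trans (trans (sym (-‿inverseʳ x)) (+-congʳ x≈y)) eq)

  0<y-x : ∀ {x y} → x < y → 0# < y - x
  0<y-x (p , x≉y) = 0≤y-x p , λ eq → x≉y (y-x≈0⇒x≈y (sym eq))

  +-nonNeg : ∀ {x y} → 0# ≤ x → 0# ≤ y → 0# ≤ x + y
  +-nonNeg {x} {y} p q = begin
    0#       ≤⟨ q ⟩
    y        ≈⟨ +-identityˡ y ⟨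
    0# + y   ≤⟨ +-monoˡ-≤ y p ⟩
    x + y    ∎

  +-mono-≤ : ∀ {x y u v} → x ≤ y → u ≤ v → x + u ≤ y + v
  +-mono-≤ {x} {y} {u} {v} p q = ≤-cert ((y - x) + (v - u))
    (solve 4 (λ x y u v → y :+ v :- (x :+ u) := (y :- x) :+ (v :- u)) refl x y u v)
    (+-nonNeg (0≤y-x p) (0≤y-x q))

  +-pos-nonNeg : ∀ {x y} → 0# < x → 0# ≤ y → 0# < x + y
  +-pos-nonNeg {x} {y} p q = begin-strict
    0#       <⟨ p ⟩
    x        ≈⟨ +-identityʳ x ⟨
    x + 0#   ≤⟨ +-mono-≤ ≤-refl q ⟩
    x + y    ∎

  neg-mono-≤ : ∀ {x y} → x ≤ y → - y ≤ - x
  neg-mono-≤ {x} {y} p = ≤-cert (y - x) (solve 2 (λ x y → :- x :- :- y := y :- x) refl x y) (0≤y-x p)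

  neg-nonNeg : ∀ {x} → x ≤ 0# → 0# ≤ - x
  neg-nonNeg {x} p = ≤-cert (0# - x) (solve 1 (λ x → :- x :- con (+ 0) := con (+ 0) :- x) refl x) (0≤y-x p)

  neg-nonPos : ∀ {x} → 0# ≤ x → - x ≤ 0#
  neg-nonPos {x} p = ≤-cert x (solve 1 (λ x → con (+ 0) :- :- x := x) refl x) p

  0≤x*x : ∀ x → 0# ≤ x * x
  0≤x*x x with total 0# x
  ... | inj₁ p = *-nonNeg p p
  ... | inj₂ p = begin
    0#          ≤⟨ *-nonNeg (neg-nonNeg p) (neg-nonNeg p) ⟩
    - x * - x   ≈⟨ solve 1 (λ x → :- x :* :- x := x :* x) refl x ⟩
    x * x       ∎

  0≤1 : 0# ≤ 1#
  0≤1 = begin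
    0#        ≤⟨ 0≤x*x 1# ⟩
    1# * 1#   ≈⟨ *-identityˡ 1# ⟩
    1#        ∎

  0<1 : 0# < 1#
  0<1 = 0≤1 , 0≉1

  0<2 : 0# < 2#
  0<2 = +-pos-nonNeg 0<1 0≤1

  >⇒≉ : ∀ {x y} → x < y → ¬ y ≈ x
  >⇒≉ (_ , x≉y) y≈x = x≉y (sym y≈x)

  *-inverseʳ : ∀ {x} → 0# < x → x * x ⁻¹ ≈ 1#
  *-inverseʳ p = ⁻¹-inverseʳ _ (>⇒≉ p)

  *-monoʳ-≤ : ∀ {z x y} → 0# ≤ z → x ≤ y → z * x ≤ z * y
  *-monoʳ-≤ {z} {x} {y} p q = ≤-cert (z * (y - x))
    (solve 3 (λ x y z → z :* y :- z :* x := z :* (y :- x)) refl x y z) (*-nonNeg p (0≤y-x q))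

  *-monoˡ-≤ : ∀ {z x y} → 0# ≤ z → x ≤ y → x * z ≤ y * z
  *-monoˡ-≤ {z} {x} {y} p q = begin
    x * z   ≈⟨ *-comm x z ⟩
    z * x   ≤⟨ *-monoʳ-≤ p q ⟩
    z * y   ≈⟨ *-comm z y ⟩
    y * z   ∎

  *-mono-≤ : ∀ {x y u v} → 0# ≤ u → 0# ≤ y → x ≤ y → u ≤ v → x * u ≤ y * v
  *-mono-≤ 0≤u 0≤y p q = ≤-trans (*-monoˡ-≤ 0≤u p) (*-monoʳ-≤ 0≤y q)

  *-pos : ∀ {x y} → 0# < x → 0# < y → 0# < x * y
  *-pos {x} {y} p@(0≤x , 0≉x) (0≤y , 0≉y) = *-nonNeg 0≤x 0≤y , λ eq → 0≉y (begin-equality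
    0#              ≈⟨ zeroʳ (x ⁻¹) ⟨
    x ⁻¹ * 0#       ≈⟨ *-congˡ eq ⟩
    x ⁻¹ * (x * y)  ≈⟨ solve 3 (λ i x y → i :* (x :* y) := x :* i :* y) refl (x ⁻¹) x y ⟩
    x * x ⁻¹ * y    ≈⟨ *-congʳ (*-inverseʳ p) ⟩
    1# * y          ≈⟨ *-identityˡ y ⟩
    y               ∎)

  ⁻¹-pos : ∀ {x} → 0# < x → 0# < x ⁻¹
  ⁻¹-pos {x} p = [ (λ q → q) , (λ q → contradiction (lemma q) (<⇒≱ 0<1)) ]′ (<-total 0# (x ⁻¹))
    where
    lemma : x ⁻¹ ≤ 0# → 1# ≤ 0#
    lemma q = begin
      1#         ≈⟨ *-inverseʳ p ⟨
      x * x ⁻¹   ≤⟨ *-monoʳ-≤ (<⇒≤ p) q ⟩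
      x * 0#     ≈⟨ zeroʳ x ⟩
      0#         ∎

  *-/-cancel : ∀ {z} x → 0# < z → (x * z) / z ≈ x
  *-/-cancel {z} x p = begin-equality
    (x * z) * z ⁻¹   ≈⟨ *-assoc x z _ ⟩
    x * (z * z ⁻¹)   ≈⟨ *-congˡ (*-inverseʳ p) ⟩
    x * 1#           ≈⟨ *-identityʳ x ⟩
    x                ∎

  /-*-cancel : ∀ {z} x → 0# < z → (x / z) * z ≈ x
  /-*-cancel {z} x p = begin-equality
    x * z ⁻¹ * z   ≈⟨ solve 3 (λ x i z → x :* i :* z := x :* z :* i) refl x (z ⁻¹) z ⟩
    x * z * z ⁻¹   ≈⟨ *-/-cancel x p ⟩
    x              ∎

  *-/-cancelˡ : ∀ {z} x → 0# < z → z * (x / z) ≈ x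
  *-/-cancelˡ {z} x p = trans (*-comm z _) (/-*-cancel x p)

  *-cancelʳ-≤ : ∀ {z x y} → 0# < z → x * z ≤ y * z → x ≤ y
  *-cancelʳ-≤ {z} {x} {y} p q = begin
    x               ≈⟨ *-/-cancel x p ⟨
    (x * z) * z ⁻¹  ≤⟨ *-monoˡ-≤ (<⇒≤ (⁻¹-pos p)) q ⟩
    (y * z) * z ⁻¹  ≈⟨ *-/-cancel y p ⟩
    y               ∎

  *-cancelʳ : ∀ {z x y} → 0# < z → x * z ≈ y * z → x ≈ y
  *-cancelʳ p q = ≤-antisym (*-cancelʳ-≤ p (≤-reflexive q)) (*-cancelʳ-≤ p (≤-reflexive (sym q)))

  *-monoˡ-< : ∀ {z x y} → 0# < z → x < y → x * z < y * z
  *-monoˡ-< {z} {x} {y} p q = <-cert ((y - x) * z)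
    (solve 3 (λ x y z → y :* z :- x :* z := (y :- x) :* z) refl x y z) (*-pos (0<y-x q) p)

  ≤/⇐*≤ : ∀ {z x y} → 0# < z → x * z ≤ y → x ≤ y / z
  ≤/⇐*≤ {z} {x} {y} p q = *-cancelʳ-≤ p (≤-trans q (≤-reflexive (sym (/-*-cancel y p))))

  /≤⇐≤* : ∀ {z x y} → 0# < z → x ≤ y * z → x / z ≤ y
  /≤⇐≤* {z} {x} {y} p q = *-cancelʳ-≤ p (≤-trans (≤-reflexive (/-*-cancel x p)) q)

  ≤/⇒*≤ : ∀ {z x y} → 0# < z → x ≤ y / z → x * z ≤ y
  ≤/⇒*≤ {z} {x} {y} p q = ≤-trans (*-monoˡ-≤ (<⇒≤ p) q) (≤-reflexive (/-*-cancel y p))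

  /-nonNeg : ∀ {x z} → 0# ≤ x → 0# < z → 0# ≤ x / z
  /-nonNeg p q = *-nonNeg p (<⇒≤ (⁻¹-pos q))

  /-pos : ∀ {x z} → 0# < x → 0# < z → 0# < x / z
  /-pos p q = *-pos p (⁻¹-pos q)

  <-dense : ∀ {x y} → x < y → ∃[ z ] (x < z × z < y)
  <-dense {x} {y} p = x + h , <-cert h (solve 2 (λ x h → x :+ h :- x := h) refl x h) 0<h ,
    <-cert h (begin-equality
      y - (x + h)         ≈⟨ solve 3 (λ x y h → y :- (x :+ h) := y :- x :- h) refl x y h ⟩
      y - x - h           ≈⟨ +-congʳ (sym (/-*-cancel (y - x) 0<2)) ⟩
      h * 2# - h          ≈⟨ solve 1 (λ h → h :* con (+ 2) :- h := h) refl h ⟩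
      h                   ∎) 0<h
    where
    h = (y - x) / 2#
    0<h = /-pos (0<y-x p) 0<2

  ∣∣-least : ∀ {x u} → x ≤ u → - x ≤ u → ∣ x ∣ ≤ u
  ∣∣-least = ⊔-lub

  ∣∣-nonNeg : ∀ x → 0# ≤ ∣ x ∣
  ∣∣-nonNeg x with total 0# x
  ... | inj₁ p = ≤-trans p (x≤x⊔y x (- x))
  ... | inj₂ p = ≤-trans (neg-nonNeg p) (x≤y⊔x x (- x))

  ∣∣-cong : ∀ {x y} → x ≈ y → ∣ x ∣ ≈ ∣ y ∣
  ∣∣-cong x≈y = ⊔-cong x≈y (-‿cong x≈y)

  ∣∣-of-nonNeg : ∀ {x} → 0# ≤ x → ∣ x ∣ ≈ x
  ∣∣-of-nonNeg {x} p = ≤-antisym (∣∣-least ≤-refl (≤-trans (neg-nonPos p) p)) (x≤x⊔y x (- x))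

  fromℕ : ℕ → ℝ
  fromℕ n = n · 1#
    where open RawSemiring (Semiring.rawSemiring semiring) renaming (_×_ to _·_)

  -- Completeness: if the multiples of `1#` were bounded, with least upper bound `s`, then `s - 1#`
  -- would bound them too, because the successor of each multiple is again one.
  archimedean : ∀ x → ∃[ n ] x < fromℕ n
  archimedean x with em {∃[ n ] x < fromℕ n}
  ... | yes p = p
  ... | no ¬p = contradiction absurd (<⇒≱ 0<1)
    where
    P : ℝ → Set
    P y = ∃[ n ] y ≈ fromℕ n
    bounded : IsUpperBound _≤_ P x
    bounded y (n , y≈n) = ≤-trans (≤-reflexive y≈n) (≤-by-contra λ x<n → ¬p (n , x<n))
    lub = complete P (0# , 0 , refl) (x , bounded)
    s = proj₁ lub
    s-1-bounds : IsUpperBound _≤_ P (s - 1#)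
    s-1-bounds y (n , y≈n) = ≤-cert (s - fromℕ (suc n))
      (trans (+-congˡ (-‿cong y≈n)) (solve 2 (λ s n → s :- con (+ 1) :- n := s :- (con (+ 1) :+ n)) refl s (fromℕ n)))
      (0≤y-x (proj₁ (proj₂ lub) _ (suc n , refl)))
    absurd : 1# ≤ 0#
    absurd = ≤-cert (s - 1# - s) (solve 1 (λ s → con (+ 0) :- con (+ 1) := s :- con (+ 1) :- s) refl s)
      (0≤y-x (proj₂ (proj₂ lub) _ s-1-bounds))

  fromℕ-nonNeg : ∀ n → 0# ≤ fromℕ n
  fromℕ-nonNeg zero    = ≤-refl
  fromℕ-nonNeg (suc n) = +-nonNeg 0≤1 (fromℕ-nonNeg n)

  fromℕ-pos : ∀ n → 0# < fromℕ (suc n)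
  fromℕ-pos n = +-pos-nonNeg 0<1 (fromℕ-nonNeg n)

  fromℕ-unbounded : ∀ x → ∃[ n ] x < fromℕ (suc n)
  fromℕ-unbounded x = let n , p = archimedean x in n , <-≤-trans p (≤-cert 1#
    (solve 1 (λ m → con (+ 1) :+ m :- m := con (+ 1)) refl (fromℕ n)) 0≤1)

  -- Suprema and infima of extended reals

  module ±-Order = NonStrict _≤_
  open ±-Order using (⊥±≤_; _≤⊤±; [≤]-injective)

  ≤±-trans : ∀ {x y z} → x ≤± y → y ≤± z → x ≤± z
  ≤±-trans = ±-Order.≤±-trans ≤-trans

  []-mono : ∀ {x y} → x ≤ y → [ x ] ≤± [ y ]
  []-mono p = ±-Order.[ p ]

  ≤±-refl : ∀ x → x ≤± x
  ≤±-refl ⊥±    = ⊥±≤ ⊥±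
  ≤±-refl [ x ] = []-mono ≤-refl
  ≤±-refl ⊤±    = ⊤± ≤⊤±

  []≰⊥± : ∀ {x} → ¬ [ x ] ≤± ⊥±
  []≰⊥± Supremum.[ () ]

  ⊤±≰[] : ∀ {x} → ¬ ⊤± ≤± [ x ]
  ⊤±≰[] ()

  -- The value `f i` is passed to `helper` as a variable with an equation, so that it can be split
  -- on while `f` stays intact inside the two decisions made by `⨆`.
  ⨆-upper : ∀ {I : Set} (f : I → ℝ̄) i → f i ≤± ⨆ f
  ⨆-upper f i = helper (f i) ≡.refl
    where
    helper : ∀ v → f i ≡ v → v ≤± ⨆ f
    helper v eq with em {∃[ x ] Below f x} | em {∃[ u ] IsUpperBound _≤_ (Below f) u}
    helper ⊥±    eq | no  _  | _     = ⊥±≤ ⊥±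
    helper [ y ] eq | no  ¬p | _     =
      contradiction (y , i , ≡.subst ([ y ] ≤±_) (≡.sym eq) ([]-mono ≤-refl)) ¬p
    helper ⊤±    eq | no  ¬p | _     =
      contradiction (0# , i , ≡.subst ([ 0# ] ≤±_) (≡.sym eq) ([ 0# ] ≤⊤±)) ¬p
    helper v     eq | yes _  | no  _ = v ≤⊤±
    helper ⊥±    eq | yes _  | yes _ = ⊥±≤ _
    helper [ y ] eq | yes p  | yes q = []-mono (proj₁ (proj₂ (complete (Below f) p q)) y
      (i , ≡.subst ([ y ] ≤±_) (≡.sym eq) ([]-mono ≤-refl)))
    helper ⊤±    eq | yes _  | yes (u , u-bounds) = contradiction
      (u-bounds (u + 1#) (i , ≡.subst ([ u + 1# ] ≤±_) (≡.sym eq) ([ u + 1# ] ≤⊤±)))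
      (<⇒≱ (<-cert 1# (solve 1 (λ u → u :+ con (+ 1) :- u := con (+ 1)) refl u) 0<1))

  ⨆-least : ∀ {I : Set} (f : I → ℝ̄) {z} → (∀ i → f i ≤± z) → ⨆ f ≤± z
  ⨆-least f {z} h with em {∃[ x ] Below f x} | em {∃[ u ] IsUpperBound _≤_ (Below f) u}
  ⨆-least f {z}     h | no  _           | _         = ⊥±≤ z
  ⨆-least f {⊥±}    h | yes (x , i , p) | _         = contradiction (≤±-trans p (h i)) []≰⊥±
  ⨆-least f {[ u ]} h | yes _           | no  ¬bdd  =
    contradiction (u , λ { x (i , p) → [≤]-injective (≤±-trans p (h i)) }) ¬bdd
  ⨆-least f {⊤±}    h | yes _           | no  _     = ⊤± ≤⊤±
  ⨆-least f {[ u ]} h | yes p           | yes q     = []-mono (proj₂ (proj₂ (complete (Below f) p q)) u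
    λ { x (i , p) → [≤]-injective (≤±-trans p (h i)) })
  ⨆-least f {⊤±}    h | yes _           | yes _     = _ ≤⊤±

  -- `exp`, `log` and sums are read off through `real`, which returns 0 at the infinities. The
  -- propositional equation with a finite value is what lets `real` compute on the supremum.
  ⨆-finite : ∀ {I : Set} (g : I → ℝ) {u} → I → (∀ i → g i ≤ u) →
             ∃[ s ] (⨆ (λ i → [ g i ]) ≡ [ s ] × (∀ i → g i ≤ s) × (∀ {v} → (∀ i → g i ≤ v) → s ≤ v))
  ⨆-finite {I} g {u} i₀ h = helper (⨆ g±) ≡.refl (⨆-upper g±) (⨆-least g±)
    where
    g± : I → ℝ̄
    g± i = [ g i ]
    helper : ∀ v → ⨆ g± ≡ v → (∀ i → g± i ≤± v) → (∀ {z} → (∀ i → g± i ≤± z) → v ≤± z) →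
             ∃[ s ] (⨆ g± ≡ [ s ] × (∀ i → g i ≤ s) × (∀ {v} → (∀ i → g i ≤ v) → s ≤ v))
    helper ⊥±    eq upper least = contradiction (upper i₀) []≰⊥±
    helper [ s ] eq upper least = s , eq , (λ i → [≤]-injective (upper i)) ,
      λ h → [≤]-injective (least λ i → []-mono (h i))
    helper ⊤±    eq upper least = contradiction (least λ i → []-mono (h i)) ⊤±≰[]

  neg-mono : ∀ {x y} → x ≤± y → neg y ≤± neg x
  neg-mono {⊥±}    {y}     p = neg y ≤⊤±
  neg-mono {[ x ]} {⊥±}    p = contradiction p []≰⊥±
  neg-mono {[ x ]} {[ y ]} p = []-mono (neg-mono-≤ ([≤]-injective p))
  neg-mono {[ x ]} {⊤±}    p = ⊥±≤ _
  neg-mono {⊤±}    {⊤±}    p = ⊥±≤ _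

  neg-neg : ∀ x → neg (neg x) ≤± x
  neg-neg ⊥±    = ⊥±≤ ⊥±
  neg-neg [ x ] = []-mono (≤-reflexive (solve 1 (λ x → :- :- x := x) refl x))
  neg-neg ⊤±    = ⊤± ≤⊤±

  ≤-neg-neg : ∀ x → x ≤± neg (neg x)
  ≤-neg-neg ⊥±    = ⊥±≤ ⊥±
  ≤-neg-neg [ x ] = []-mono (≤-reflexive (solve 1 (λ x → x := :- :- x) refl x))
  ≤-neg-neg ⊤±    = ⊤± ≤⊤±

  ⨅-lower : ∀ {I : Set} (f : I → ℝ̄) i → ⨅ f ≤± f i
  ⨅-lower f i = ≤±-trans (neg-mono (⨆-upper (λ i → neg (f i)) i)) (neg-neg (f i))

  ⨅-greatest : ∀ {I : Set} (f : I → ℝ̄) {z} → (∀ i → z ≤± f i) → z ≤± ⨅ f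
  ⨅-greatest f {z} h = ≤±-trans (≤-neg-neg z) (neg-mono (⨆-least (λ i → neg (f i)) λ i → neg-mono (h i)))

  -- Exponential, logarithm and powers

  open RawSemiring (Semiring.rawSemiring semiring) using () renaming (_^_ to _^ⁿ_)
  open Exp semiring using (^-congˡ; ^-assocʳ)
  open CommutativeExp (CommutativeRing.commutativeSemiring commutativeRing) using (^-distrib-*)

  ^ⁿ-nonNeg : ∀ {x} n → 0# ≤ x → 0# ≤ x ^ⁿ n
  ^ⁿ-nonNeg zero    p = 0≤1
  ^ⁿ-nonNeg (suc n) p = *-nonNeg p (^ⁿ-nonNeg n p)

  ^ⁿ-pos : ∀ {x} n → 0# < x → 0# < x ^ⁿ n
  ^ⁿ-pos zero    p = 0<1
  ^ⁿ-pos (suc n) p = *-pos p (^ⁿ-pos n p)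

  ^ⁿ-mono : ∀ {x y} n → 0# ≤ x → x ≤ y → x ^ⁿ n ≤ y ^ⁿ n
  ^ⁿ-mono zero    p q = ≤-refl
  ^ⁿ-mono (suc n) p q = *-mono-≤ (^ⁿ-nonNeg n p) (≤-trans p q) q (^ⁿ-mono n p q)

  1^ⁿ : ∀ n → 1# ^ⁿ n ≈ 1#
  1^ⁿ zero    = refl
  1^ⁿ (suc n) = trans (*-identityˡ _) (1^ⁿ n)

  bernoulli : ∀ {z} n → 0# ≤ 1# + z → 1# + fromℕ n * z ≤ (1# + z) ^ⁿ n
  bernoulli {z} zero    p = ≤-reflexive (solve 1 (λ z → con (+ 1) :+ con (+ 0) :* z := con (+ 1)) refl z)
  bernoulli {z} (suc n) p = begin
    1# + (1# + fromℕ n) * z              ≤⟨ ≤-cert (fromℕ n * (z * z))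
        (solve 2 (λ z n → (con (+ 1) :+ z) :* (con (+ 1) :+ n :* z) :- (con (+ 1) :+ (con (+ 1) :+ n) :* z) := n :* (z :* z))
          refl z (fromℕ n))
        (*-nonNeg (fromℕ-nonNeg n) (0≤x*x z)) ⟩
    (1# + z) * (1# + fromℕ n * z)        ≤⟨ *-monoʳ-≤ p (bernoulli n p) ⟩
    (1# + z) * (1# + z) ^ⁿ n             ∎

  -- The step sizes z for which (1 + z)ⁿ⁺¹ is one of the approximations whose supremum is exp x.
  record IsStep (x : ℝ) (n : ℕ) (z : ℝ) : Set where
    constructor _,_
    field
      scaled   : fromℕ (suc n) * z ≈ x
      positive : 0# < 1# + z
  open IsStep

  -- Bernoulli gives 1 + z ≤ (1 + z/M)ᴹ, so a finer subdivision does not lower the approximation;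
  -- this is how steps with different indices are made comparable. The successor of the new index is
  -- `suc n ℕ.* suc m` by computation.
  refine : ∀ {x n z} m → IsStep x n z →
           ∃[ w ] (IsStep x (m ℕ.+ n ℕ.* suc m) w × (1# + z) ^ⁿ suc n ≤ (1# + w) ^ⁿ (suc n ℕ.* suc m))
  refine {x} {n} {z} m (eq , 0<1+z) = w , (eq′ , 0<1+w) , power
    where
    M = fromℕ (suc m)
    w = z / M
    Mw≈z : M * w ≈ z
    Mw≈z = *-/-cancelˡ z (fromℕ-pos m)
    eq′ : fromℕ (suc n ℕ.* suc m) * w ≈ x
    eq′ = begin-equality
      fromℕ (suc n ℕ.* suc m) * w   ≈⟨ *-congʳ (Mult.×1-homo-* semiring (suc n) (suc m)) ⟩
      fromℕ (suc n) * M * w         ≈⟨ *-assoc _ _ _ ⟩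
      fromℕ (suc n) * (M * w)       ≈⟨ *-congˡ Mw≈z ⟩
      fromℕ (suc n) * z             ≈⟨ eq ⟩
      x                             ∎
    0<1+w : 0# < 1# + w
    0<1+w with total 0# w
    ... | inj₁ p = +-pos-nonNeg 0<1 p
    -- For `w ≤ 0#` the multiple `z` of `w` by `M ≥ 1#` lies below `w`, so positivity passes from
    -- `1# + z` to `1# + w`.
    ... | inj₂ p = <-≤-trans 0<1+z (+-mono-≤ ≤-refl (begin
      z                                   ≈⟨ Mw≈z ⟨
      (1# + fromℕ m) * w                  ≤⟨ ≤-cert (fromℕ m * - w)
        (solve 2 (λ m w → w :- (con (+ 1) :+ m) :* w := m :* :- w) refl (fromℕ m) w)
        (*-nonNeg (fromℕ-nonNeg m) (neg-nonNeg p)) ⟩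
      w                                   ∎))
    power : (1# + z) ^ⁿ suc n ≤ (1# + w) ^ⁿ (suc n ℕ.* suc m)
    power = begin
      (1# + z) ^ⁿ suc n                   ≤⟨ ^ⁿ-mono (suc n) (<⇒≤ 0<1+z) (begin
          1# + z                              ≈⟨ +-congˡ Mw≈z ⟨
          1# + M * w                          ≤⟨ bernoulli (suc m) (<⇒≤ 0<1+w) ⟩
          (1# + w) ^ⁿ suc m                   ∎) ⟩
      ((1# + w) ^ⁿ suc m) ^ⁿ suc n        ≈⟨ ^-assocʳ (1# + w) (suc m) (suc n) ⟩
      (1# + w) ^ⁿ (suc m ℕ.* suc n)       ≡⟨ ≡.cong ((1# + w) ^ⁿ_) (ℕ.*-comm (suc m) (suc n)) ⟩
      (1# + w) ^ⁿ (suc n ℕ.* suc m)       ∎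

  *-cancelˡ : ∀ {z x y} → 0# < z → z * x ≈ z * y → x ≈ y
  *-cancelˡ {z} {x} {y} p q = *-cancelʳ p (trans (*-comm x z) (trans q (*-comm z y)))

  nonNeg-factor : ∀ {z x} → 0# < z → 0# ≤ z * x → 0# ≤ x
  nonNeg-factor {z} {x} p q = *-cancelʳ-≤ p (≤-trans (≤-reflexive (zeroˡ z)) (≤-trans q (≤-reflexive (*-comm z x))))

  -- For steps of opposite sign `z * w ≤ 0#`, hence (1 + z)(1 + w) ≤ 1 + (z + w), and `z + w` is a
  -- step for `x + y`. The bounds `a` and `b` leave room for approximations that were refined
  -- beforehand.
  combine-aligned : ∀ {x y z w a b} k → 0# ≤ x → y ≤ 0# → 0# ≤ a → 0# ≤ b →
    IsStep x k z → IsStep y k w → a ≤ (1# + z) ^ⁿ suc k → b ≤ (1# + w) ^ⁿ suc k →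
    ∃[ j ] ∃[ v ] (IsStep (x + y) j v × a * b ≤ (1# + v) ^ⁿ suc j)
  combine-aligned {x} {y} {z} {w} {a} {b} k 0≤x y≤0 0≤a 0≤b (eqz , 0<1+z) (eqw , 0<1+w) a≤ b≤ =
      k , z + w , (trans (distribˡ K z w) (+-cong eqz eqw) , 0<1+v) , (begin
      a * b                                             ≤⟨ *-mono-≤ 0≤b (^ⁿ-nonNeg (suc k) (<⇒≤ 0<1+z)) a≤ b≤ ⟩
      (1# + z) ^ⁿ suc k * (1# + w) ^ⁿ suc k             ≈⟨ ^-distrib-* (1# + z) (1# + w) (suc k) ⟨
      ((1# + z) * (1# + w)) ^ⁿ suc k                    ≤⟨ ^ⁿ-mono (suc k) (<⇒≤ 0<prod) prod≤ ⟩
      (1# + (z + w)) ^ⁿ suc k                           ∎)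
    where
    K = fromℕ (suc k)
    0≤z : 0# ≤ z
    0≤z = nonNeg-factor (fromℕ-pos k) (≤-trans 0≤x (≤-reflexive (sym eqz)))
    0≤-w : 0# ≤ - w
    0≤-w = nonNeg-factor (fromℕ-pos k) (≤-trans (neg-nonNeg y≤0) (≤-reflexive
      (trans (-‿cong (sym eqw)) (solve 2 (λ k w → :- (k :* w) := k :* :- w) refl K w))))
    0<prod : 0# < (1# + z) * (1# + w)
    0<prod = *-pos 0<1+z 0<1+w
    prod≤ : (1# + z) * (1# + w) ≤ 1# + (z + w)
    prod≤ = ≤-cert (z * - w)
      (solve 2 (λ z w → con (+ 1) :+ (z :+ w) :- (con (+ 1) :+ z) :* (con (+ 1) :+ w) := z :* :- w) refl z w)
      (*-nonNeg 0≤z 0≤-w)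
    0<1+v : 0# < 1# + (z + w)
    0<1+v = <-≤-trans 0<prod prod≤

  -- Each step is refined by the number of subdivisions of the other. The two resulting indices
  -- agree only up to commutativity of the product, hence the transports.
  combine : ∀ {x y n m z w} → 0# ≤ x → y ≤ 0# → IsStep x n z → IsStep y m w →
            ∃[ k ] ∃[ v ] (IsStep (x + y) k v × (1# + z) ^ⁿ suc n * (1# + w) ^ⁿ suc m ≤ (1# + v) ^ⁿ suc k)
  combine {x} {y} {n} {m} {z} {w} 0≤x y≤0 Sx@(_ , 0<1+z) Sy@(_ , 0<1+w) =
    combine-aligned (m ℕ.+ n ℕ.* suc m) 0≤x y≤0 (^ⁿ-nonNeg (suc n) (<⇒≤ 0<1+z)) (^ⁿ-nonNeg (suc m) (<⇒≤ 0<1+w)) Sz′ Sw′ powz poww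
    where
    K≡ : suc m ℕ.* suc n ≡ suc n ℕ.* suc m
    K≡ = ℕ.*-comm (suc m) (suc n)
    rx = refine m Sx
    ry = refine n Sy
    Sz′ = proj₁ (proj₂ rx)
    powz = proj₂ (proj₂ rx)
    Sw′ = ≡.subst (λ k → IsStep y k (proj₁ ry)) (ℕ.suc-injective K≡) (proj₁ (proj₂ ry))
    poww = ≡.subst (λ k → (1# + w) ^ⁿ suc m ≤ (1# + proj₁ ry) ^ⁿ k) K≡ (proj₂ (proj₂ ry))

  canonical-step : ∀ x n → - x < fromℕ (suc n) → IsStep x n (x / fromℕ (suc n))
  canonical-step x n p = *-/-cancelˡ x (fromℕ-pos n) , <-respʳ-≈ (begin-equality
      (x + M) / M          ≈⟨ solve 3 (λ x m i → (x :+ m) :* i := m :* i :+ x :* i) refl x M (M ⁻¹) ⟩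
      M * M ⁻¹ + x / M     ≈⟨ +-congʳ (*-inverseʳ (fromℕ-pos n)) ⟩
      1# + x / M           ∎)
    (/-pos (<-respʳ-≈ (solve 2 (λ x m → m :- :- x := x :+ m) refl x M) (0<y-x p)) (fromℕ-pos n))
    where
    M = fromℕ (suc n)

  some-step : ∀ x → ∃[ n ] ∃[ z ] IsStep x n z
  some-step x = let n , p = fromℕ-unbounded (- x) in n , _ , canonical-step x n p

  step-zero : ∀ {x n z} → x ≈ 0# → IsStep x n z → (1# + z) ^ⁿ suc n ≈ 1#
  step-zero {x} {n} {z} x≈0 (eq , _) = trans (^-congˡ (suc n) (trans (+-congˡ z≈0) (+-identityʳ 1#))) (1^ⁿ (suc n))
    where
    z≈0 : z ≈ 0#
    z≈0 = *-cancelˡ (fromℕ-pos n) (trans eq (trans x≈0 (sym (zeroʳ _))))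

  approximation-nonPos : ∀ {x n z} → x ≤ 0# → IsStep x n z → (1# + z) ^ⁿ suc n ≤ 1#
  approximation-nonPos {x} {n} {z} x≤0 (eq , 0<1+z) = begin
    (1# + z) ^ⁿ suc n   ≤⟨ ^ⁿ-mono (suc n) (<⇒≤ 0<1+z) 1+z≤1 ⟩
    1# ^ⁿ suc n         ≈⟨ 1^ⁿ (suc n) ⟩
    1#                  ∎
    where
    0≤-z : 0# ≤ - z
    0≤-z = nonNeg-factor (fromℕ-pos n) (≤-trans (neg-nonNeg x≤0) (≤-reflexive
      (trans (-‿cong (sym eq)) (solve 2 (λ k w → :- (k :* w) := k :* :- w) refl (fromℕ (suc n)) z))))
    1+z≤1 : 1# + z ≤ 1#
    1+z≤1 = ≤-cert (- z) (solve 1 (λ z → con (+ 1) :- (con (+ 1) :+ z) := :- z) refl z) 0≤-z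

  -- The combined step belongs to the argument 0, where every approximation equals 1.
  approximation-*-neg : ∀ {x n z m w} → 0# ≤ x → IsStep x n z → IsStep (- x) m w →
                        (1# + z) ^ⁿ suc n * (1# + w) ^ⁿ suc m ≤ 1#
  approximation-*-neg {x} 0≤x Sz Sw =
    let k , v , Sv , le = combine 0≤x (neg-nonPos 0≤x) Sz Sw in
    ≤-trans le (≤-reflexive (step-zero (-‿inverseʳ x) Sv))

  -- Without a bound the supremum in `exp` would be `⊤±`, which `real` sends to 0. For `x`
  -- nonnegative the reciprocal of a single approximation of `exp (- x)` serves.
  approximations-bounded : ∀ x → ∃[ u ] (∀ n z → IsStep x n z → (1# + z) ^ⁿ suc n ≤ u)
  approximations-bounded x with total 0# x
  ... | inj₂ x≤0 = 1# , λ n z → approximation-nonPos x≤0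
  ... | inj₁ 0≤x =
    let m , w , Sw = some-step (- x) in
    1# / (1# + w) ^ⁿ suc m , λ n z Sz → ≤/⇐*≤ (^ⁿ-pos (suc m) (positive Sw)) (approximation-*-neg 0≤x Sz Sw)

  -- The universal property of `exp`. Quantifying over all `IsStep`s, and not over the quotients of
  -- the definition, lets steps for different arguments be added, negated and refined without
  -- rewriting quotients.
  exp-spec : ∀ x → (∀ n z → IsStep x n z → (1# + z) ^ⁿ suc n ≤ exp x) ×
                   (∀ {u} → (∀ n z → IsStep x n z → (1# + z) ^ⁿ suc n ≤ u) → exp x ≤ u)
  exp-spec x = upper , least
    where
    bounds = proj₂ (approximations-bounded x)
    S₀ = proj₂ (proj₂ (some-step x))
    I : Set
    I = ∃[ n ] 0# < 1# + x / fromℕ (suc n)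
    approx : I → ℝ
    approx (n , _) = (1# + x / fromℕ (suc n)) ^ⁿ suc n
    step≈ : ∀ {n z} → IsStep x n z → 1# + z ≈ 1# + x / fromℕ (suc n)
    step≈ {n} (eq , _) = +-congˡ (*-cancelˡ (fromℕ-pos n) (trans eq (sym (*-/-cancelˡ x (fromℕ-pos n)))))
    index : ∀ {n z} → IsStep x n z → I
    index {n} S = n , <-respʳ-≈ (step≈ S) (positive S)
    canonical : ∀ ((n , p) : I) → IsStep x n (x / fromℕ (suc n))
    canonical (n , p) = *-/-cancelˡ x (fromℕ-pos n) , p
    sup = ⨆-finite approx (index S₀) (λ i → bounds _ _ (canonical i))
    exp≡ : exp x ≡ proj₁ sup
    exp≡ = ≡.cong real (proj₁ (proj₂ sup))
    upper : ∀ n z → IsStep x n z → (1# + z) ^ⁿ suc n ≤ exp x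
    upper n z S = begin
      (1# + z) ^ⁿ suc n                     ≈⟨ ^-congˡ (suc n) (step≈ S) ⟩
      (1# + x / fromℕ (suc n)) ^ⁿ suc n     ≤⟨ proj₁ (proj₂ (proj₂ sup)) (index S) ⟩
      proj₁ sup                             ≡⟨ exp≡ ⟨
      exp x                                 ∎
    least : ∀ {u} → (∀ n z → IsStep x n z → (1# + z) ^ⁿ suc n ≤ u) → exp x ≤ u
    least h = ≤-trans (≤-reflexive (reflexive exp≡)) (proj₂ (proj₂ (proj₂ sup)) λ i → h _ _ (canonical i))

  exp-upper : ∀ {x n z} → IsStep x n z → (1# + z) ^ⁿ suc n ≤ exp x
  exp-upper S = proj₁ (exp-spec _) _ _ S

  exp-*-least : ∀ {x c u} → 0# < c → (∀ {n z} → IsStep x n z → (1# + z) ^ⁿ suc n * c ≤ u) → exp x * c ≤ u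
  exp-*-least {x} {c} {u} 0<c h = ≤/⇒*≤ 0<c (proj₂ (exp-spec x) λ n z S → ≤/⇐*≤ 0<c (h S))

  exp-cong-≤ : ∀ {x y} → x ≈ y → exp x ≤ exp y
  exp-cong-≤ {x} {y} x≈y = proj₂ (exp-spec x) λ { n z (eq , p) → exp-upper {y} {n} {z} (trans eq x≈y , p) }

  exp-cong : ∀ {x y} → x ≈ y → exp x ≈ exp y
  exp-cong p = ≤-antisym (exp-cong-≤ p) (exp-cong-≤ (sym p))

  exp-pos : ∀ x → 0# < exp x
  exp-pos x = let n , z , S = some-step x in <-≤-trans (^ⁿ-pos (suc n) (positive S)) (exp-upper S)

  -- The functional equation of the exponential.

  exp-*-≤ : ∀ {x y} → 0# ≤ x → y ≤ 0# → exp x * exp y ≤ exp (x + y)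
  exp-*-≤ {x} {y} 0≤x y≤0 = exp-*-least (exp-pos y) λ {n} {z} Sx → begin
    (1# + z) ^ⁿ suc n * exp y    ≈⟨ *-comm _ _ ⟩
    exp y * (1# + z) ^ⁿ suc n    ≤⟨ exp-*-least (^ⁿ-pos (suc n) (positive Sx)) (λ Sy → lemma Sx Sy) ⟩
    exp (x + y)                  ∎
    where
    lemma : ∀ {n z m w} → IsStep x n z → IsStep y m w → (1# + w) ^ⁿ suc m * (1# + z) ^ⁿ suc n ≤ exp (x + y)
    lemma Sx Sy = let k , v , S , le = combine 0≤x y≤0 Sx Sy in
      ≤-trans (≤-reflexive (*-comm _ _)) (≤-trans le (exp-upper S))

  -‿factor : ∀ {k z x} → k * z ≈ x → k * - z ≈ - x
  -‿factor {k} {z} eq = trans (solve 2 (λ k z → k :* :- z := :- (k :* z)) refl k z) (-‿cong eq)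

  SameSign : ℝ → ℝ → Set
  SameSign x y = (0# ≤ x × 0# ≤ y) ⊎ (0# ≤ - x × 0# ≤ - y)

  1+-pos : ∀ {z w} → SameSign z w → 0# < 1# + (z + w) → 0# < 1# + z
  1+-pos {z} {w} (inj₁ (p , q)) 0<1+z+w = +-pos-nonNeg 0<1 p
  1+-pos {z} {w} (inj₂ (p , q)) 0<1+z+w = <-≤-trans 0<1+z+w
    (≤-cert (- w) (solve 2 (λ z w → con (+ 1) :+ z :- (con (+ 1) :+ (z :+ w)) := :- w) refl z w) q)

  *-sameSign : ∀ {z w} → SameSign z w → 0# ≤ z * w
  *-sameSign         (inj₁ (p , q)) = *-nonNeg p q
  *-sameSign {z} {w} (inj₂ (p , q)) =
    ≤-trans (*-nonNeg p q) (≤-reflexive (solve 2 (λ z w → :- z :* :- w := z :* w) refl z w))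

  -- For steps of equal sign `z * w` is nonnegative, which reverses the comparison used in
  -- `combine-aligned`.
  approximation-+-≤ : ∀ {x y z w} n → SameSign z w → fromℕ (suc n) * z ≈ x → fromℕ (suc n) * w ≈ y →
                      0# < 1# + (z + w) → (1# + (z + w)) ^ⁿ suc n ≤ exp x * exp y
  approximation-+-≤ {x} {y} {z} {w} n same Nz≈x Nw≈y 0<1+z+w = begin
    (1# + (z + w)) ^ⁿ suc n                 ≤⟨ ^ⁿ-mono (suc n) (<⇒≤ 0<1+z+w) (≤-cert (z * w)
        (solve 2 (λ z w → (con (+ 1) :+ z) :* (con (+ 1) :+ w) :- (con (+ 1) :+ (z :+ w)) := z :* w) refl z w)
        (*-sameSign same)) ⟩
    ((1# + z) * (1# + w)) ^ⁿ suc n          ≈⟨ ^-distrib-* (1# + z) (1# + w) (suc n) ⟩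
    (1# + z) ^ⁿ suc n * (1# + w) ^ⁿ suc n   ≤⟨ *-mono-≤ (^ⁿ-nonNeg (suc n) (<⇒≤ (positive Sy)))
                                                 (<⇒≤ (exp-pos x)) (exp-upper Sx) (exp-upper Sy) ⟩
    exp x * exp y                           ∎
    where
    Sx : IsStep x n z
    Sx = Nz≈x , 1+-pos same 0<1+z+w
    Sy : IsStep y n w
    Sy = Nw≈y , 1+-pos (Sum.map swap swap same) (<-respʳ-≈ (+-congˡ (+-comm z w)) 0<1+z+w)

  sameSign-factor : ∀ {k z w x y} → 0# < k → k * z ≈ x → k * w ≈ y → SameSign x y → SameSign z w
  sameSign-factor 0<k eqz eqw = Sum.map
    (λ (p , q) → factor eqz p , factor eqw q)
    (λ (p , q) → factor (-‿factor eqz) p , factor (-‿factor eqw) q)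
    where
    factor : ∀ {z x} → _ * z ≈ x → 0# ≤ x → 0# ≤ z
    factor eq p = nonNeg-factor 0<k (≤-trans p (≤-reflexive (sym eq)))

  exp-+-≤ : ∀ {x y} → SameSign x y → exp (x + y) ≤ exp x * exp y
  exp-+-≤ {x} {y} same = proj₂ (exp-spec (x + y)) bound
    where
    bound : ∀ n s → IsStep (x + y) n s → (1# + s) ^ⁿ suc n ≤ exp x * exp y
    bound n s (eq , 0<1+s) = begin
      (1# + s) ^ⁿ suc n                       ≈⟨ ^-congˡ (suc n) (+-congˡ s≈z+w) ⟩
      (1# + (z + w)) ^ⁿ suc n                 ≤⟨ approximation-+-≤ n (sameSign-factor (fromℕ-pos n) Nz≈x Nw≈y same)
                                                   Nz≈x Nw≈y (<-respʳ-≈ (+-congˡ s≈z+w) 0<1+s) ⟩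
      exp x * exp y                           ∎
      where
      z = x / fromℕ (suc n)
      w = y / fromℕ (suc n)
      Nz≈x : fromℕ (suc n) * z ≈ x
      Nz≈x = *-/-cancelˡ x (fromℕ-pos n)
      Nw≈y : fromℕ (suc n) * w ≈ y
      Nw≈y = *-/-cancelˡ y (fromℕ-pos n)
      s≈z+w : s ≈ z + w
      s≈z+w = *-cancelˡ (fromℕ-pos n) (trans eq (sym (trans (distribˡ _ z w) (+-cong Nz≈x Nw≈y))))

  exp0≤1 : ∀ {x} → x ≈ 0# → exp x ≤ 1#
  exp0≤1 {x} x≈0 = proj₂ (exp-spec x) λ n z S → ≤-reflexive (step-zero x≈0 S)

  exp-*-neg-≤ : ∀ x → exp x * exp (- x) ≤ 1#
  exp-*-neg-≤ x with total 0# x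
  ... | inj₁ p = ≤-trans (exp-*-≤ p (neg-nonPos p)) (exp0≤1 (-‿inverseʳ x))
  ... | inj₂ p = ≤-trans (≤-reflexive (*-comm _ _)) (≤-trans (exp-*-≤ (neg-nonNeg p) p) (exp0≤1 (-‿inverseˡ x)))

  -- The approximations of index n multiply to (1 - x²/n²)ⁿ, which Bernoulli bounds below by 1 -
  -- x²/n; here n stands for `fromℕ (suc n)`. The bound on `∣ x ∣` makes the steps of both `x` and
  -- `- x` admissible.
  exp-*-neg-≥-approx : ∀ x n → ∣ x ∣ < fromℕ (suc n) → 1# - x * (x / fromℕ (suc n)) ≤ exp x * exp (- x)
  exp-*-neg-≥-approx x n p = begin
    1# - x * z                                   ≈⟨ +-congˡ (-‿cong (*-congʳ (scaled Sx))) ⟨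
    1# - N * z * z                               ≈⟨ solve 2 (λ n z → con (+ 1) :- n :* z :* z := con (+ 1) :+ n :* :- (z :* z)) refl N z ⟩
    1# + N * - (z * z)                           ≤⟨ bernoulli (suc n) (≤-trans (<⇒≤ (*-pos (positive Sx) (positive S-x))) (≤-reflexive prod≈)) ⟩
    (1# + - (z * z)) ^ⁿ suc n                    ≈⟨ ^-congˡ (suc n) prod≈ ⟨
    ((1# + z) * (1# + - x / N)) ^ⁿ suc n         ≈⟨ ^-distrib-* (1# + z) (1# + - x / N) (suc n) ⟩
    (1# + z) ^ⁿ suc n * (1# + - x / N) ^ⁿ suc n  ≤⟨ *-mono-≤ (^ⁿ-nonNeg (suc n) (<⇒≤ (positive S-x)))
                                                      (<⇒≤ (exp-pos x)) (exp-upper Sx) (exp-upper S-x) ⟩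
    exp x * exp (- x)                            ∎
    where
    N = fromℕ (suc n)
    z = x / N
    Sx : IsStep x n z
    Sx = canonical-step x n (≤-<-trans (x≤y⊔x x (- x)) p)
    S-x : IsStep (- x) n (- x / N)
    S-x = canonical-step (- x) n (≤-<-trans (≤-trans (≤-reflexive (solve 1 (λ x → :- :- x := x) refl x)) (x≤x⊔y x (- x))) p)
    prod≈ : (1# + z) * (1# + - x / N) ≈ 1# + - (z * z)
    prod≈ = solve 2 (λ x i → (con (+ 1) :+ x :* i) :* (con (+ 1) :+ :- x :* i) := con (+ 1) :+ :- (x :* i :* (x :* i))) refl x (N ⁻¹)

  exp-*-neg-≥ : ∀ x → 1# ≤ exp x * exp (- x)
  exp-*-neg-≥ x = ≤-by-contra λ E<1 →
    -- The index must exceed `∣ x ∣` for the steps to be admissible, and x² divided by the supposed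
    -- deficit `1# - exp x * exp (- x)` for the error x²/n to fall below that deficit. The sum of
    -- the two ensures both.
    let n , p = fromℕ-unbounded (∣ x ∣ + x * x / (1# - exp x * exp (- x))) in
    <⇒≱ (lemma E<1 n p) (exp-*-neg-≥-approx x n (≤-<-trans (≤-cert (x * x / (1# - exp x * exp (- x)))
      (solve 2 (λ a b → a :+ b :- a := b) refl ∣ x ∣ _) (/-nonNeg (0≤x*x x) (0<y-x E<1))) p))
    where
    lemma : exp x * exp (- x) < 1# → ∀ n → ∣ x ∣ + x * x / (1# - exp x * exp (- x)) < fromℕ (suc n) →
            exp x * exp (- x) < 1# - x * (x / fromℕ (suc n))
    lemma E<1 n p = <-cert (δ - x * (x / N))
      (solve 2 (λ e t → con (+ 1) :- t :- e := con (+ 1) :- e :- t) refl E (x * (x / N))) (0<y-x small)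
      where
      N = fromℕ (suc n)
      E = exp x * exp (- x)
      δ = 1# - E
      0<δ : 0# < δ
      0<δ = 0<y-x E<1
      small : x * (x / N) < δ
      small = begin-strict
        x * (x / N)                ≈⟨ *-assoc x x _ ⟨
        x * x / N                  ≈⟨ *-congʳ (/-*-cancel (x * x) 0<δ) ⟨
        x * x / δ * δ / N          <⟨ *-monoˡ-< (⁻¹-pos (fromℕ-pos n)) (*-monoˡ-< 0<δ (≤-<-trans
                                        (≤-cert ∣ x ∣ (solve 2 (λ a b → a :+ b :- b := a) refl ∣ x ∣ _) (∣∣-nonNeg x)) p)) ⟩
        N * δ / N                  ≈⟨ *-congʳ (*-comm N δ) ⟩
        δ * N / N                  ≈⟨ *-/-cancel δ (fromℕ-pos n) ⟩
        δ                          ∎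

  exp-*-neg : ∀ x → exp x * exp (- x) ≈ 1#
  exp-*-neg x = ≤-antisym (exp-*-neg-≤ x) (exp-*-neg-≥ x)

  inverse-antimono : ∀ {a a′ b b′} → 0# ≤ a → 0# ≤ b → a * a′ ≈ 1# → b * b′ ≈ 1# → a′ ≤ b′ → b ≤ a
  inverse-antimono {a} {a′} {b} {b′} 0≤a 0≤b aa′ bb′ p = begin
    b               ≈⟨ *-identityʳ b ⟨
    b * 1#          ≈⟨ *-congˡ aa′ ⟨
    b * (a * a′)    ≈⟨ *-assoc b a a′ ⟨
    b * a * a′      ≤⟨ *-monoʳ-≤ (*-nonNeg 0≤b 0≤a) p ⟩
    b * a * b′      ≈⟨ solve 3 (λ a b b′ → b :* a :* b′ := a :* (b :* b′)) refl a b b′ ⟩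
    a * (b * b′)    ≈⟨ *-congˡ bb′ ⟩
    a * 1#          ≈⟨ *-identityʳ a ⟩
    a               ∎

  exp-neg-+ : ∀ x y → (exp x * exp y) * (exp (- x) * exp (- y)) ≈ 1#
  exp-neg-+ x y = begin-equality
    (exp x * exp y) * (exp (- x) * exp (- y))
      ≈⟨ solve 4 (λ a b c d → a :* b :* (c :* d) := a :* c :* (b :* d)) refl (exp x) (exp y) (exp (- x)) (exp (- y)) ⟩
    (exp x * exp (- x)) * (exp y * exp (- y))   ≈⟨ *-cong (exp-*-neg x) (exp-*-neg y) ⟩
    1# * 1#                                     ≈⟨ *-identityʳ 1# ⟩
    1#                                          ∎

  -‿+ : ∀ x y → - (x + y) ≈ - x + - y
  -‿+ = solve 2 (λ x y → :- (x :+ y) := :- x :+ :- y) refl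

  exp-*-nonNeg : ∀ x y → 0# ≤ exp x * exp y
  exp-*-nonNeg x y = *-nonNeg (<⇒≤ (exp-pos x)) (<⇒≤ (exp-pos y))

  -- Approximations yield one inequality only. The converse is the same inequality for `- x` and
  -- `- y`, inverted by means of `exp-*-neg`.
  exp-+-sameSign : ∀ {x y} → SameSign x y → exp (x + y) ≈ exp x * exp y
  exp-+-sameSign {x} {y} same = ≤-antisym (exp-+-≤ same)
    (inverse-antimono (<⇒≤ (exp-pos (x + y))) (exp-*-nonNeg x y) (exp-*-neg (x + y)) (exp-neg-+ x y) (begin
      exp (- (x + y))             ≈⟨ exp-cong (-‿+ x y) ⟩
      exp (- x + - y)             ≤⟨ exp-+-≤ (negate same) ⟩
      exp (- x) * exp (- y)       ∎))
    where
    double : ∀ {x} → 0# ≤ x → 0# ≤ - - x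
    double {x} p = ≤-trans p (≤-reflexive (solve 1 (λ x → x := :- :- x) refl x))
    negate : ∀ {x y} → SameSign x y → SameSign (- x) (- y)
    negate (inj₁ (p , q)) = inj₂ (double p , double q)
    negate (inj₂ (p , q)) = inj₁ (p , q)

  exp-+-oppositeSign : ∀ {x y} → 0# ≤ x → y ≤ 0# → exp (x + y) ≈ exp x * exp y
  exp-+-oppositeSign {x} {y} 0≤x y≤0 = ≤-antisym
    (inverse-antimono (exp-*-nonNeg x y) (<⇒≤ (exp-pos (x + y))) (exp-neg-+ x y) (exp-*-neg (x + y)) (begin
      exp (- x) * exp (- y)       ≈⟨ *-comm _ _ ⟩
      exp (- y) * exp (- x)       ≤⟨ exp-*-≤ (neg-nonNeg y≤0) (neg-nonPos 0≤x) ⟩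
      exp (- y + - x)             ≈⟨ exp-cong (solve 2 (λ x y → :- y :+ :- x := :- (x :+ y)) refl x y) ⟩
      exp (- (x + y))             ∎))
    (exp-*-≤ 0≤x y≤0)

  exp-+ : ∀ x y → exp (x + y) ≈ exp x * exp y
  exp-+ x y with total 0# x | total 0# y
  ... | inj₁ p | inj₁ q = exp-+-sameSign (inj₁ (p , q))
  ... | inj₁ p | inj₂ q = exp-+-oppositeSign p q
  ... | inj₂ p | inj₁ q = trans (exp-cong (+-comm x y)) (trans (exp-+-oppositeSign q p) (*-comm _ _))
  ... | inj₂ p | inj₂ q = exp-+-sameSign (inj₂ (neg-nonNeg p , neg-nonNeg q))

  -- Tangent and trapezoid inequalities for the exponential.

  1+x≤exp : ∀ x → 1# + x ≤ exp x
  1+x≤exp x with <-total 0# (1# + x)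
  ... | inj₂ p = ≤-trans p (<⇒≤ (exp-pos x))
  ... | inj₁ p = begin
    1# + x             ≈⟨ *-identityʳ (1# + x) ⟨
    (1# + x) ^ⁿ 1      ≤⟨ exp-upper {x} {0} {x} (solve 1 (λ x → (con (+ 1) :+ con (+ 0)) :* x := x) refl x , p) ⟩
    exp x              ∎

  -- The tangent at `x` lies below the graph of `exp`. Monotonicity and the surjectivity of `exp`
  -- onto the positive reals both rest on this.
  exp-≤-factor : ∀ x y → exp x * (1# + (y - x)) ≤ exp y
  exp-≤-factor x y = begin
    exp x * (1# + (y - x))     ≤⟨ *-monoʳ-≤ (<⇒≤ (exp-pos x)) (1+x≤exp (y - x)) ⟩
    exp x * exp (y - x)        ≈⟨ exp-+ x (y - x) ⟨
    exp (x + (y - x))          ≈⟨ exp-cong (solve 2 (λ x y → x :+ (y :- x) := y) refl x y) ⟩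
    exp y                      ∎

  exp-mono-< : ∀ {x y} → x < y → exp x < exp y
  exp-mono-< {x} {y} p = <-≤-trans (<-cert (exp x * (y - x))
    (solve 2 (λ e d → e :* (con (+ 1) :+ d) :- e := e :* d) refl (exp x) (y - x))
    (*-pos (exp-pos x) (0<y-x p))) (exp-≤-factor x y)

  exp-cancel-≤ : ∀ {x y} → exp x ≤ exp y → x ≤ y
  exp-cancel-≤ p = ≤-by-contra λ y<x → <⇒≱ (exp-mono-< y<x) p

  exp-mono-≤ : ∀ {x y} → x ≤ y → exp x ≤ exp y
  exp-mono-≤ {x} {y} p = ≤-trans (≤-cert (exp x * (y - x))
    (solve 2 (λ e d → e :* (con (+ 1) :+ d) :- e := e :* d) refl (exp x) (y - x))
    (*-nonNeg (<⇒≤ (exp-pos x)) (0≤y-x p))) (exp-≤-factor x y)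

  exp-injective : ∀ {x y} → exp x ≈ exp y → x ≈ y
  exp-injective p = ≤-antisym (exp-cancel-≤ (≤-reflexive p)) (exp-cancel-≤ (≤-reflexive (sym p)))

  -- A discrete form of exp t ≤ 1 + t exp t, needed for the increment in the induction of
  -- `trapezoid-power`.
  power≤1+ : ∀ {s} n → 0# ≤ s → (1# + s) ^ⁿ n ≤ 1# + fromℕ n * s * (1# + s) ^ⁿ n
  power≤1+ {s} zero    p = ≤-reflexive (solve 1 (λ s → con (+ 1) := con (+ 1) :+ con (+ 0) :* s :* con (+ 1)) refl s)
  power≤1+ {s} (suc n) p = ≤-cert ((1# + N * s * A - A) + (1# + N) * s * s * A)
    (solve 3 (λ s n a → con (+ 1) :+ (con (+ 1) :+ n) :* s :* ((con (+ 1) :+ s) :* a) :- (con (+ 1) :+ s) :* a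
       := (con (+ 1) :+ n :* s :* a :- a) :+ (con (+ 1) :+ n) :* s :* s :* a) refl s N A)
    (+-nonNeg (0≤y-x (power≤1+ n p)) (*-nonNeg (*-nonNeg (*-nonNeg (fromℕ-nonNeg (suc n)) p) p) (^ⁿ-nonNeg n (+-nonNeg 0≤1 p))))
    where
    N = fromℕ n
    A = (1# + s) ^ⁿ n

  -- The discrete form of `exp-trapezoid`. From `n` to `suc n` the right side gains
  -- `s * (1# + N * s * A - A + s * A)` on the left side, and this is nonnegative by `power≤1+`.
  trapezoid-power : ∀ {s} n → 0# ≤ s → 2# * ((1# + s) ^ⁿ n - 1#) ≤ fromℕ n * s * ((1# + s) ^ⁿ n + 1#)
  trapezoid-power {s} zero    p = ≤-reflexive
    (solve 1 (λ s → con (+ 2) :* (con (+ 1) :- con (+ 1)) := con (+ 0) :* s :* (con (+ 1) :+ con (+ 1))) refl s)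
  trapezoid-power {s} (suc n) p =
    ≤-cert ((N * s * (A + 1#) - 2# * (A - 1#)) + s * (1# + N * s * A - A + s * A))
    (solve 3 (λ s n a → (con (+ 1) :+ n) :* s :* ((con (+ 1) :+ s) :* a :+ con (+ 1)) :- con (+ 2) :* ((con (+ 1) :+ s) :* a :- con (+ 1))
       := (n :* s :* (a :+ con (+ 1)) :- con (+ 2) :* (a :- con (+ 1))) :+ s :* (con (+ 1) :+ n :* s :* a :- a :+ s :* a)) refl s N A)
    (+-nonNeg (0≤y-x (trapezoid-power n p))
      (*-nonNeg p (+-nonNeg (0≤y-x (power≤1+ n p)) (*-nonNeg p (^ⁿ-nonNeg n (+-nonNeg 0≤1 p))))))
    where
    N = fromℕ n
    A = (1# + s) ^ⁿ n

  -- Equivalent to tanh (t / 2) ≤ t / 2.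
  exp-trapezoid : ∀ {t} → 0# ≤ t → 2# * (exp t - 1#) ≤ t * (exp t + 1#)
  exp-trapezoid {t} 0≤t = ≤-cert (2# + t - exp t * (2# - t))
    (solve 2 (λ t e → t :* (e :+ con (+ 1)) :- con (+ 2) :* (e :- con (+ 1)) := con (+ 2) :+ t :- e :* (con (+ 2) :- t)) refl t (exp t))
    (0≤y-x bound)
    where
    step : ∀ {n z} → IsStep t n z → (1# + z) ^ⁿ suc n * (2# - t) ≤ 2# + t
    step {n} {z} S = ≤-cert (t * (A + 1#) - 2# * (A - 1#))
      (solve 2 (λ t e → con (+ 2) :+ t :- e :* (con (+ 2) :- t) := t :* (e :+ con (+ 1)) :- con (+ 2) :* (e :- con (+ 1))) refl t A)
      (0≤y-x (≤-trans (trapezoid-power (suc n) 0≤z) (≤-reflexive (*-congʳ (scaled S)))))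
      where
      A = (1# + z) ^ⁿ suc n
      0≤z : 0# ≤ z
      0≤z = nonNeg-factor (fromℕ-pos n) (≤-trans 0≤t (≤-reflexive (sym (scaled S))))
    -- With `exp t` collected on one side the supremum passes through the inequality, provided its
    -- factor `2# - t` is positive; otherwise the signs of the two sides decide.
    bound : exp t * (2# - t) ≤ 2# + t
    bound with <-total 0# (2# - t)
    ... | inj₁ p = exp-*-least p step
    ... | inj₂ p = begin
      exp t * (2# - t)   ≤⟨ *-monoʳ-≤ (<⇒≤ (exp-pos t)) p ⟩
      exp t * 0#         ≈⟨ zeroʳ _ ⟩
      0#                 ≤⟨ +-nonNeg (<⇒≤ 0<2) 0≤t ⟩
      2# + t             ∎

  -- The logarithm.

  log-spec : ∀ {y} → 0# < y → (∀ x → exp x ≤ y → x ≤ log y) × (∀ {u} → (∀ x → exp x ≤ y → x ≤ u) → log y ≤ u)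
  log-spec {y} 0<y = (λ x p → ≤-trans (upper (x , p)) (≤-reflexive (reflexive (≡.sym log≡)))) ,
    λ h → ≤-trans (≤-reflexive (reflexive log≡)) (least λ (x , p) → h x p)
    where
    I : Set
    I = ∃[ x ] exp x ≤ y
    -- Nonemptiness: `exp (- (1# / y)) ≤ y` because its reciprocal `exp (1# / y)` is at least
    -- `1# / y`.
    i₀ : I
    i₀ = - (1# / y) , (begin
      exp (- (1# / y))                    ≈⟨ *-/-cancel _ 0<y ⟨
      exp (- (1# / y)) * y / y            ≈⟨ solve 3 (λ e y i → e :* y :* i := (con (+ 1) :* i) :* e :* y) refl (exp (- (1# / y))) y (y ⁻¹) ⟩
      1# / y * exp (- (1# / y)) * y       ≤⟨ *-monoˡ-≤ (<⇒≤ 0<y) (*-monoˡ-≤ (<⇒≤ (exp-pos _))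
                                               (≤-trans (≤-cert 1# (solve 1 (λ z → con (+ 1) :+ z :- z := con (+ 1)) refl (1# / y)) 0≤1) (1+x≤exp (1# / y)))) ⟩
      exp (1# / y) * exp (- (1# / y)) * y ≈⟨ *-congʳ (exp-*-neg (1# / y)) ⟩
      1# * y                              ≈⟨ *-identityˡ y ⟩
      y                                   ∎)
    bound : ∀ (i : I) → proj₁ i ≤ y
    bound (x , p) = ≤-trans (≤-cert 1# (solve 1 (λ z → con (+ 1) :+ z :- z := con (+ 1)) refl x) 0≤1) (≤-trans (1+x≤exp x) p)
    sup = ⨆-finite proj₁ i₀ bound
    log≡ : log y ≡ proj₁ sup
    log≡ = ≡.cong real (proj₁ (proj₂ sup))
    upper = proj₁ (proj₂ (proj₂ sup))
    least = proj₂ (proj₂ (proj₂ sup))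

  -- An explicit shift `h` replaces continuity. If `exp L` exceeds `y`, the tangent at `L` shows
  -- that `L - h` is still an upper bound; if it falls short, the tangent at `L + h` shows
  -- `exp (L + h) ≤ y`. In each case `h` is the relative error that turns the tangent estimate into
  -- `y` exactly.
  exp-log : ∀ {y} → 0# < y → exp (log y) ≈ y
  exp-log {y} 0<y = ≤-antisym (≤-by-contra above) (≤-by-contra below)
    where
    L = log y
    above : ¬ y < exp L
    above y<eL = <⇒≱ (<-cert h (solve 2 (λ l h → l :- (l :- h) := h) refl L h) 0<h)
      (proj₂ (log-spec 0<y) λ x p → exp-cancel-≤ (≤-trans p y≤))
      where
      h = (exp L - y) / exp L
      0<h = /-pos (0<y-x y<eL) (exp-pos L)
      y≤ : y ≤ exp (L - h)
      y≤ = begin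
        y                                ≈⟨ solve 2 (λ e y → y := e :- (e :- y)) refl (exp L) y ⟩
        exp L - (exp L - y)              ≈⟨ +-congˡ (-‿cong (*-/-cancelˡ _ (exp-pos L))) ⟨
        exp L - exp L * h                ≈⟨ solve 3 (λ e l h → e :- e :* h := e :* (con (+ 1) :+ (l :- h :- l))) refl (exp L) L h ⟩
        exp L * (1# + (L - h - L))       ≤⟨ exp-≤-factor L (L - h) ⟩
        exp (L - h)                      ∎
    below : ¬ exp L < y
    below eL<y = <⇒≱ (<-cert h (solve 2 (λ l h → l :+ h :- l := h) refl L h) 0<h)
      -- Both sides are multiplied by `exp L`, which is known to be positive, so that the sign of
      -- `1# - h` need not be discussed.
      (proj₁ (log-spec 0<y) (L + h) (*-cancelʳ-≤ (exp-pos L) (begin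
        exp (L + h) * exp L               ≈⟨ *-congˡ eL≈ ⟩
        exp (L + h) * (y * (1# - h))      ≈⟨ solve 4 (λ a y h l → a :* (y :* (con (+ 1) :- h)) := y :* (a :* (con (+ 1) :+ (l :- (l :+ h))))) refl (exp (L + h)) y h L ⟩
        y * (exp (L + h) * (1# + (L - (L + h))))   ≤⟨ *-monoʳ-≤ (<⇒≤ 0<y) (exp-≤-factor (L + h) L) ⟩
        y * exp L                         ∎)))
      where
      h = (y - exp L) / y
      0<h = /-pos (0<y-x eL<y) 0<y
      eL≈ : exp L ≈ y * (1# - h)
      eL≈ = begin-equality
        exp L                  ≈⟨ solve 2 (λ e y → e := y :- (y :- e)) refl (exp L) y ⟩
        y - (y - exp L)        ≈⟨ +-congˡ (-‿cong (*-/-cancelˡ _ 0<y)) ⟨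
        y - y * h              ≈⟨ solve 2 (λ y h → y :- y :* h := y :* (con (+ 1) :- h)) refl y h ⟩
        y * (1# - h)           ∎

  -- Real powers and their convexity.

  ^-of-pos : ∀ {x} p → 0# < x → x ^ p ≈ exp (p * log x)
  ^-of-pos {x} p 0<x with em {0# < x}
  ... | yes _  = refl
  ... | no  ¬q = contradiction 0<x ¬q

  ^-of-nonPos : ∀ {x} p → x ≤ 0# → x ^ p ≈ 0#
  ^-of-nonPos {x} p x≤0 with em {0# < x}
  ... | yes q = contradiction x≤0 (<⇒≱ q)
  ... | no  _ = refl

  log-exp : ∀ x → log (exp x) ≈ x
  log-exp x = exp-injective (exp-log (exp-pos x))

  log-cong : ∀ {x y} → 0# < x → x ≈ y → log x ≈ log y
  log-cong 0<x x≈y = exp-injective (trans (exp-log 0<x) (trans x≈y (sym (exp-log (<-respʳ-≈ x≈y 0<x)))))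

  log-* : ∀ {x y} → 0# < x → 0# < y → log (x * y) ≈ log x + log y
  log-* {x} {y} 0<x 0<y = exp-injective (begin-equality
    exp (log (x * y))             ≈⟨ exp-log (*-pos 0<x 0<y) ⟩
    x * y                         ≈⟨ *-cong (exp-log 0<x) (exp-log 0<y) ⟨
    exp (log x) * exp (log y)     ≈⟨ exp-+ (log x) (log y) ⟨
    exp (log x + log y)           ∎)

  log-mono-≤ : ∀ {x y} → 0# < x → x ≤ y → log x ≤ log y
  log-mono-≤ 0<x x≤y = exp-cancel-≤ (≤-trans (≤-reflexive (exp-log 0<x))
    (≤-trans x≤y (≤-reflexive (sym (exp-log (<-≤-trans 0<x x≤y))))))

  exp-^ : ∀ x p → exp x ^ p ≈ exp (p * x)
  exp-^ x p = trans (^-of-pos p (exp-pos x)) (exp-cong (*-congˡ (log-exp x)))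

  ^-pos : ∀ {x} p → 0# < x → 0# < x ^ p
  ^-pos p 0<x = <-respʳ-≈ (sym (^-of-pos p 0<x)) (exp-pos _)

  ^-nonNeg : ∀ x p → 0# ≤ x ^ p
  ^-nonNeg x p with <-total 0# x
  ... | inj₁ 0<x = <⇒≤ (^-pos p 0<x)
  ... | inj₂ x≤0 = ≤-reflexive (sym (^-of-nonPos p x≤0))

  ^-cong : ∀ {x y} p → x ≈ y → x ^ p ≈ y ^ p
  ^-cong {x} {y} p x≈y with <-total 0# x
  ... | inj₂ x≤0 = trans (^-of-nonPos p x≤0) (sym (^-of-nonPos p (≤-trans (≤-reflexive (sym x≈y)) x≤0)))
  ... | inj₁ 0<x = begin-equality
    x ^ p              ≈⟨ ^-of-pos p 0<x ⟩
    exp (p * log x)    ≈⟨ exp-cong (*-congˡ (log-cong 0<x x≈y)) ⟩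
    exp (p * log y)    ≈⟨ ^-of-pos p (<-respʳ-≈ x≈y 0<x) ⟨
    y ^ p              ∎

  ^-mono-≤ : ∀ {x y p} → 0# ≤ p → x ≤ y → x ^ p ≤ y ^ p
  ^-mono-≤ {x} {y} {p} 0≤p x≤y with <-total 0# x
  ... | inj₂ x≤0 = ≤-trans (≤-reflexive (^-of-nonPos p x≤0)) (^-nonNeg y p)
  ... | inj₁ 0<x = begin
    x ^ p              ≈⟨ ^-of-pos p 0<x ⟩
    exp (p * log x)    ≤⟨ exp-mono-≤ (*-monoʳ-≤ 0≤p (log-mono-≤ 0<x x≤y)) ⟩
    exp (p * log y)    ≈⟨ ^-of-pos p (<-≤-trans 0<x x≤y) ⟨
    y ^ p              ∎

  ^-root : ∀ {x p} → 0# < x → 0# < p → (x ^ (1# / p)) ^ p ≈ x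
  ^-root {x} {p} 0<x 0<p = begin-equality
    (x ^ (1# / p)) ^ p              ≈⟨ ^-cong p (^-of-pos (1# / p) 0<x) ⟩
    exp (1# / p * log x) ^ p        ≈⟨ exp-^ _ p ⟩
    exp (p * (1# / p * log x))      ≈⟨ exp-cong (trans (sym (*-assoc p _ _)) (trans (*-congʳ (*-/-cancelˡ 1# 0<p)) (*-identityˡ _))) ⟩
    exp (log x)                     ≈⟨ exp-log 0<x ⟩
    x                               ∎

  ^-mono-< : ∀ {x y p} → 0# < p → 0# < x → x < y → x ^ p < y ^ p
  ^-mono-< {x} {y} {p} 0<p 0<x x<y = ≰⇒> λ le → <⇒≱ (lemma le) (exp-cancel-≤ (begin
      exp (p * log y)      ≈⟨ ^-of-pos p 0<y ⟨
      y ^ p                ≤⟨ le ⟩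
      x ^ p                ≈⟨ ^-of-pos p 0<x ⟩
      exp (p * log x)      ∎))
    where
    0<y = <-trans 0<x x<y
    lemma : y ^ p ≤ x ^ p → p * log x < p * log y
    lemma _ = <-respˡ-≈ (*-comm _ p) (<-respʳ-≈ (*-comm _ p) (*-monoˡ-< 0<p (≰⇒> λ le →
      <⇒≱ x<y (begin y ≈⟨ exp-log 0<y ⟨ exp (log y) ≤⟨ exp-mono-≤ le ⟩ exp (log x) ≈⟨ exp-log 0<x ⟩ x ∎))))

  *-^ : ∀ {x y} p → 0# ≤ x → 0# ≤ y → (x * y) ^ p ≈ x ^ p * y ^ p
  *-^ {x} {y} p 0≤x 0≤y with <-total 0# x | <-total 0# y
  ... | inj₂ x≤0 | _ = begin-equality
    (x * y) ^ p      ≈⟨ ^-of-nonPos p (≤-trans (*-monoˡ-≤ 0≤y x≤0) (≤-reflexive (zeroˡ y))) ⟩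
    0#               ≈⟨ zeroˡ _ ⟨
    0# * y ^ p       ≈⟨ *-congʳ (^-of-nonPos p x≤0) ⟨
    x ^ p * y ^ p    ∎
  ... | inj₁ _ | inj₂ y≤0 = begin-equality
    (x * y) ^ p      ≈⟨ ^-of-nonPos p (≤-trans (*-monoʳ-≤ 0≤x y≤0) (≤-reflexive (zeroʳ x))) ⟩
    0#               ≈⟨ zeroʳ _ ⟨
    x ^ p * 0#       ≈⟨ *-congˡ (^-of-nonPos p y≤0) ⟨
    x ^ p * y ^ p    ∎
  ... | inj₁ 0<x | inj₁ 0<y = begin-equality
    (x * y) ^ p                          ≈⟨ ^-of-pos p (*-pos 0<x 0<y) ⟩
    exp (p * log (x * y))                ≈⟨ exp-cong (trans (*-congˡ (log-* 0<x 0<y)) (distribˡ p _ _)) ⟩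
    exp (p * log x + p * log y)          ≈⟨ exp-+ _ _ ⟩
    exp (p * log x) * exp (p * log y)    ≈⟨ *-cong (^-of-pos p 0<x) (^-of-pos p 0<y) ⟨
    x ^ p * y ^ p                        ∎

  -- With s = log x, xᵖ = x exp ((p - 1) s) ≥ x (1 + (p - 1) s), and x s ≥ x - 1 follows from x (1 -
  -- s) ≤ x exp (- s) = 1. The sign of p - 1 is where `1# ≤ p` enters.
  bernoulli-^ : ∀ {x p} → 1# ≤ p → 0# < x → 1# + p * (x - 1#) ≤ x ^ p
  bernoulli-^ {x} {p} 1≤p 0<x = begin
    1# + p * (x - 1#)                       ≤⟨ ≤-cert ((p - 1#) * (1# - x * (1# + - s)))
        (solve 3 (λ x p s → x :* (con (+ 1) :+ (p :- con (+ 1)) :* s) :- (con (+ 1) :+ p :* (x :- con (+ 1)))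
          := (p :- con (+ 1)) :* (con (+ 1) :- x :* (con (+ 1) :+ :- s))) refl x p s)
        (*-nonNeg (0≤y-x 1≤p) (0≤y-x xe≤1)) ⟩
    x * (1# + (p - 1#) * s)                 ≤⟨ *-monoʳ-≤ (<⇒≤ 0<x) (1+x≤exp ((p - 1#) * s)) ⟩
    x * exp ((p - 1#) * s)                  ≈⟨ *-congʳ (exp-log 0<x) ⟨
    exp s * exp ((p - 1#) * s)              ≈⟨ exp-+ _ _ ⟨
    exp (s + (p - 1#) * s)                  ≈⟨ exp-cong (solve 2 (λ p s → s :+ (p :- con (+ 1)) :* s := p :* s) refl p s) ⟩
    exp (p * s)                             ≈⟨ ^-of-pos p 0<x ⟨
    x ^ p                                   ∎
    where
    s = log x
    xe≤1 : x * (1# + - s) ≤ 1#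
    xe≤1 = begin
      x * (1# + - s)        ≤⟨ *-monoʳ-≤ (<⇒≤ 0<x) (1+x≤exp (- s)) ⟩
      x * exp (- s)         ≈⟨ *-congʳ (exp-log 0<x) ⟨
      exp s * exp (- s)     ≈⟨ exp-*-neg s ⟩
      1#                    ∎

  -- Both points are compared with the tangent of the power function at the midpoint `z`; the linear
  -- terms cancel because `x / z + y / z ≈ 2#`.
  ^-midpoint : ∀ {x y p} → 1# ≤ p → 0# < x → 0# < y → 2# * ((x + y) / 2#) ^ p ≤ x ^ p + y ^ p
  ^-midpoint {x} {y} {p} 1≤p 0<x 0<y = begin
    2# * z ^ p                                                          ≈⟨ *-comm 2# _ ⟩
    z ^ p * 2#                                                          ≈⟨ *-congˡ (begin-equality
        2#                                                                 ≈⟨ solve 1 (λ p → con (+ 2) := con (+ 2) :+ p :* (con (+ 2) :- con (+ 2))) refl p ⟩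
        2# + p * (2# - 2#)                                                 ≈⟨ +-congˡ (*-congˡ (+-congʳ x/z+y/z≈2)) ⟨
        2# + p * (x / z + y / z - 2#)                                      ≈⟨ solve 3 (λ p a b → con (+ 2) :+ p :* (a :+ b :- con (+ 2))
                                                                                 := con (+ 1) :+ p :* (a :- con (+ 1)) :+ (con (+ 1) :+ p :* (b :- con (+ 1)))) refl p (x / z) (y / z) ⟩
        1# + p * (x / z - 1#) + (1# + p * (y / z - 1#))                    ∎) ⟩
    z ^ p * (1# + p * (x / z - 1#) + (1# + p * (y / z - 1#)))           ≈⟨ distribˡ _ _ _ ⟩
    z ^ p * (1# + p * (x / z - 1#)) + z ^ p * (1# + p * (y / z - 1#))   ≤⟨ +-mono-≤ (tangent 0<x) (tangent 0<y) ⟩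
    x ^ p + y ^ p                                                       ∎
    where
    z = (x + y) / 2#
    0<z : 0# < z
    0<z = /-pos (+-pos-nonNeg 0<x (<⇒≤ 0<y)) 0<2
    x/z+y/z≈2 : x / z + y / z ≈ 2#
    x/z+y/z≈2 = *-cancelʳ 0<z (begin-equality
      (x / z + y / z) * z   ≈⟨ distribʳ z _ _ ⟩
      x / z * z + y / z * z ≈⟨ +-cong (/-*-cancel x 0<z) (/-*-cancel y 0<z) ⟩
      x + y                 ≈⟨ *-/-cancelˡ (x + y) 0<2 ⟨
      2# * z                ∎)
    tangent : ∀ {x} → 0# < x → z ^ p * (1# + p * (x / z - 1#)) ≤ x ^ p
    tangent {x} 0<x = begin
      z ^ p * (1# + p * (x / z - 1#))    ≤⟨ *-monoʳ-≤ (^-nonNeg z p) (bernoulli-^ 1≤p (/-pos 0<x 0<z)) ⟩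
      z ^ p * (x / z) ^ p                ≈⟨ *-^ p (<⇒≤ 0<z) (<⇒≤ (/-pos 0<x 0<z)) ⟨
      (z * (x / z)) ^ p                  ≈⟨ ^-cong p (*-/-cancelˡ x 0<z) ⟩
      x ^ p                              ∎

  exp-difference-≤ : ∀ {x y} → y ≤ x → exp x - exp y ≤ (x - y) * ((exp x + exp y) / 2#)
  exp-difference-≤ {x} {y} y≤x = *-cancelʳ-≤ 0<2 (begin
    (exp x - exp y) * 2#                              ≈⟨ *-congʳ (+-congʳ ex≈) ⟩
    (exp y * exp t - exp y) * 2#                      ≈⟨ solve 2 (λ e f → (e :* f :- e) :* con (+ 2) := e :* (con (+ 2) :* (f :- con (+ 1)))) refl (exp y) (exp t) ⟩
    exp y * (2# * (exp t - 1#))                       ≤⟨ *-monoʳ-≤ (<⇒≤ (exp-pos y)) (exp-trapezoid (0≤y-x y≤x)) ⟩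
    exp y * (t * (exp t + 1#))                        ≈⟨ solve 3 (λ e t f → e :* (t :* (f :+ con (+ 1))) := t :* (e :* f :+ e)) refl (exp y) t (exp t) ⟩
    t * (exp y * exp t + exp y)                       ≈⟨ *-congˡ (+-congʳ ex≈) ⟨
    t * (exp x + exp y)                               ≈⟨ *-congˡ (/-*-cancel _ 0<2) ⟨
    t * ((exp x + exp y) / 2# * 2#)                   ≈⟨ *-assoc t _ 2# ⟨
    t * ((exp x + exp y) / 2#) * 2#                   ∎)
    where
    t = x - y
    ex≈ : exp x ≈ exp y * exp t
    ex≈ = trans (exp-cong (solve 2 (λ x y → x := y :+ (x :- y)) refl x y)) (exp-+ y t)

  -- The factor 2 comes from comparing with the mean of the two exponentials, not their maximum.
  exp-difference-^ : ∀ {x y p δ} → 1# ≤ p → ∣ x - y ∣ ≤ δ →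
                     2# * ∣ exp x - exp y ∣ ^ p ≤ (exp x ^ p + exp y ^ p) * δ ^ p
  exp-difference-^ {x} {y} {p} {δ} 1≤p d≤ = begin
    2# * ∣ exp x - exp y ∣ ^ p              ≤⟨ *-monoʳ-≤ (<⇒≤ 0<2) (^-mono-≤ 0≤p ∣∣≤) ⟩
    2# * (δ * z) ^ p                        ≈⟨ *-congˡ (*-^ p 0≤δ (<⇒≤ 0<z)) ⟩
    2# * (δ ^ p * z ^ p)                    ≈⟨ solve 3 (λ a b c → a :* (b :* c) := a :* c :* b) refl 2# (δ ^ p) (z ^ p) ⟩
    2# * z ^ p * δ ^ p                      ≤⟨ *-monoˡ-≤ (^-nonNeg δ p) (^-midpoint 1≤p (exp-pos x) (exp-pos y)) ⟩
    (exp x ^ p + exp y ^ p) * δ ^ p         ∎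
    where
    0≤p = ≤-trans 0≤1 1≤p
    z = (exp x + exp y) / 2#
    0<z : 0# < z
    0<z = /-pos (+-pos-nonNeg (exp-pos x) (<⇒≤ (exp-pos y))) 0<2
    0≤δ : 0# ≤ δ
    0≤δ = ≤-trans (∣∣-nonNeg (x - y)) d≤
    ordered : ∀ {x y} → x - y ≤ δ → exp x - exp y ≤ δ * ((exp x + exp y) / 2#)
    ordered {x} {y} d with total y x
    ... | inj₁ y≤x = ≤-trans (exp-difference-≤ y≤x) (*-monoˡ-≤ (/-nonNeg (+-nonNeg (<⇒≤ (exp-pos x)) (<⇒≤ (exp-pos y))) 0<2) d)
    ... | inj₂ x≤y = begin
      exp x - exp y                  ≤⟨ ≤-cert (exp y - exp x) (solve 2 (λ a b → con (+ 0) :- (a :- b) := b :- a) refl (exp x) (exp y)) (0≤y-x (exp-mono-≤ x≤y)) ⟩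
      0#                             ≤⟨ *-nonNeg 0≤δ (/-nonNeg (+-nonNeg (<⇒≤ (exp-pos x)) (<⇒≤ (exp-pos y))) 0<2) ⟩
      δ * ((exp x + exp y) / 2#)     ∎
    ∣∣≤ : ∣ exp x - exp y ∣ ≤ δ * z
    ∣∣≤ = ∣∣-least (ordered (≤-trans (x≤x⊔y _ _) d≤)) (begin
      - (exp x - exp y)              ≈⟨ solve 2 (λ a b → :- (a :- b) := b :- a) refl (exp x) (exp y) ⟩
      exp y - exp x                  ≤⟨ ordered (≤-trans (≤-reflexive (solve 2 (λ a b → b :- a := :- (a :- b)) refl x y)) (≤-trans (x≤y⊔x _ _) d≤)) ⟩
      δ * ((exp y + exp x) / 2#)     ≈⟨ *-congˡ (*-congʳ (+-comm _ _)) ⟩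
      δ * z                          ∎)

  -- Sums

  Σ : {A : Set} → (A → ℝ) → List A → ℝ
  Σ f xs = foldr _+_ 0# (map f xs)

  Σ-cong : ∀ {A : Set} {f g : A → ℝ} → (∀ x → f x ≈ g x) → ∀ xs → Σ f xs ≈ Σ g xs
  Σ-cong h []       = refl
  Σ-cong h (x ∷ xs) = +-cong (h x) (Σ-cong h xs)

  Σ-mono-All : ∀ {A : Set} {f g : A → ℝ} {xs} → All (λ x → f x ≤ g x) xs → Σ f xs ≤ Σ g xs
  Σ-mono-All []       = ≤-refl
  Σ-mono-All (h ∷ hs) = +-mono-≤ h (Σ-mono-All hs)

  Σ-mono : ∀ {A : Set} {f g : A → ℝ} → (∀ x → f x ≤ g x) → ∀ xs → Σ f xs ≤ Σ g xs
  Σ-mono h xs = Σ-mono-All (All.universal h xs)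

  Σ-+ : ∀ {A : Set} (f g : A → ℝ) xs → Σ (λ x → f x + g x) xs ≈ Σ f xs + Σ g xs
  Σ-+ f g []       = sym (+-identityˡ 0#)
  Σ-+ f g (x ∷ xs) = begin-equality
    (f x + g x) + Σ (λ x → f x + g x) xs    ≈⟨ +-congˡ (Σ-+ f g xs) ⟩
    (f x + g x) + (Σ f xs + Σ g xs)         ≈⟨ solve 4 (λ a b c d → a :+ b :+ (c :+ d) := a :+ c :+ (b :+ d)) refl (f x) (g x) (Σ f xs) (Σ g xs) ⟩
    (f x + Σ f xs) + (g x + Σ g xs)         ∎

  Σ-*ˡ : ∀ {A : Set} c (f : A → ℝ) xs → Σ (λ x → c * f x) xs ≈ c * Σ f xs
  Σ-*ˡ c f []       = sym (zeroʳ c)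
  Σ-*ˡ c f (x ∷ xs) = trans (+-congˡ (Σ-*ˡ c f xs)) (sym (distribˡ c (f x) (Σ f xs)))

  Σ-nonNeg : ∀ {A : Set} {f : A → ℝ} → (∀ x → 0# ≤ f x) → ∀ xs → 0# ≤ Σ f xs
  Σ-nonNeg h []       = ≤-refl
  Σ-nonNeg h (x ∷ xs) = +-nonNeg (h x) (Σ-nonNeg h xs)

  Σ-map : ∀ {A B : Set} (f : B → ℝ) (g : A → B) xs → Σ f (map g xs) ≈ Σ (f ∘ g) xs
  Σ-map f g []       = refl
  Σ-map f g (x ∷ xs) = +-congˡ (Σ-map f g xs)

  Σ-partition : ∀ {A : Set} (f : A → ℝ) {P : Pred A 0ℓ} (P? : ∀ x → Dec (P x)) xs →
                Σ f xs ≈ Σ f (filter P? xs) + Σ f (filter (¬? ∘ P?) xs)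
  Σ-partition f P? []       = sym (+-identityˡ 0#)
  Σ-partition f P? (x ∷ xs) with P? x
  ... | yes _ = trans (+-congˡ (Σ-partition f P? xs)) (sym (+-assoc _ _ _))
  ... | no  _ = trans (+-congˡ (Σ-partition f P? xs))
    (solve 3 (λ a b c → a :+ (b :+ c) := b :+ (a :+ c)) refl (f x) _ _)

  Σ-zero : ∀ {A : Set} {f : A → ℝ} {xs} → All (λ x → f x ≈ 0#) xs → Σ f xs ≈ 0#
  Σ-zero []       = refl
  Σ-zero (p ∷ ps) = trans (+-cong p (Σ-zero ps)) (+-identityˡ 0#)

  Σ-∈ : ∀ {A : Set} {f : A → ℝ} {x} {xs} → (∀ y → 0# ≤ f y) → x ∈ xs → f x ≤ Σ f xs
  Σ-∈ {f = f} {xs = x ∷ xs} h (here ≡.refl) = ≤-cert (Σ f xs) (solve 2 (λ a b → a :+ b :- a := b) refl (f x) (Σ f xs)) (Σ-nonNeg h xs)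
  Σ-∈ {f = f} {xs = x ∷ xs} h (there p)     = ≤-trans (Σ-∈ h p)
    (≤-cert (f x) (solve 2 (λ a b → a :+ b :- b := a) refl (f x) (Σ f xs)) (h x))

  fibre-≡ : ∀ {A B : Set} {z : A} {ps : List (A × B)} → All (λ p → proj₁ p ≡ z) ps → map (z ,_) (map proj₂ ps) ≡ ps
  fibre-≡ []                = ≡.refl
  fibre-≡ (≡.refl ∷ fibres) = ≡.cong (_ ∷_) (fibre-≡ fibres)

  module _ {A B : Set} (k : A → B → ℝ) (g u : A → ℝ)
           (g-nonNeg : ∀ x → 0# ≤ g x) (bound : ∀ x {ys} → Unique ys → Σ (k x) ys ≤ u x) where

    private
      term : A × B → ℝ
      term (x , y) = k x y * g x

    Σ-fibre : ∀ {z ps} → Unique ps → All (λ p → proj₁ p ≡ z) ps → Σ term ps ≤ g z * u z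
    Σ-fibre {z} {ps} ps! fibre = begin
      Σ term ps                             ≡⟨ ≡.cong (Σ term) (fibre-≡ fibre) ⟨
      Σ term (map (z ,_) ys)                ≈⟨ Σ-map term (z ,_) ys ⟩
      Σ (λ y → k z y * g z) ys              ≈⟨ Σ-cong (λ y → *-comm (k z y) (g z)) ys ⟩
      Σ (λ y → g z * k z y) ys              ≈⟨ Σ-*ˡ (g z) (k z) ys ⟩
      g z * Σ (k z) ys                      ≤⟨ *-monoʳ-≤ (g-nonNeg z)
                                                 (bound z (Unique.map⁻ (≡.subst Unique (≡.sym (fibre-≡ fibre)) ps!))) ⟩
      g z * u z                             ∎
      where ys = map proj₂ ps

    -- Pairs are grouped by their first component, one element of `zs` at a time, and `bound`
    -- controls the sum along each group. Pairs over no element of `zs` contribute nothing since `g`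
    -- vanishes there. A repetition in `zs` is harmless: its second group is empty and its bound
    -- nonnegative.
    Σ-fibres : ∀ zs {ps} → Unique ps → All (λ p → proj₁ p ∈ zs ⊎ g (proj₁ p) ≈ 0#) ps →
               Σ term ps ≤ Σ (λ z → g z * u z) zs
    Σ-fibres []       {ps} ps! supp = ≤-reflexive (Σ-zero (All.map vanish supp))
      where
      vanish : ∀ {p : A × B} → proj₁ p ∈ [] ⊎ g (proj₁ p) ≈ 0# → term p ≈ 0#
      vanish (inj₂ g≈0) = trans (*-congˡ g≈0) (zeroʳ _)
    Σ-fibres (z ∷ zs) {ps} ps! supp = begin
      Σ term ps                                               ≈⟨ Σ-partition term over-z? ps ⟩
      Σ term (filter over-z? ps) + Σ term (filter (¬? ∘ over-z?) ps)
        ≤⟨ +-mono-≤ (Σ-fibre (Unique.filter⁺ over-z? ps!) (All.all-filter over-z? ps))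
                    (Σ-fibres zs (Unique.filter⁺ (¬? ∘ over-z?) ps!)
                      (All.map (λ {p} → other {p}) (All.zip (All.filter⁺ (¬? ∘ over-z?) supp , All.all-filter (¬? ∘ over-z?) ps)))) ⟩
      g z * u z + Σ (λ z → g z * u z) zs                      ∎
      where
      over-z? : ∀ (p : A × B) → Dec (proj₁ p ≡ z)
      over-z? p = em
      other : ∀ {p : A × B} → (proj₁ p ∈ z ∷ zs ⊎ g (proj₁ p) ≈ 0#) × ¬ proj₁ p ≡ z → proj₁ p ∈ zs ⊎ g (proj₁ p) ≈ 0#
      other (inj₁ (here eq) , ≢z) = contradiction eq ≢z
      other (inj₁ (there p) , _)  = inj₁ p
      other (inj₂ g≈0       , _)  = inj₂ g≈0

  -- A special case of `Σ-fibres` with second components in `⊤`: a duplicate-free list then has at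
  -- most one entry in each fibre.
  Σ-support : ∀ {A : Set} {f : A → ℝ} {zs xs} → (∀ x → 0# ≤ f x) → Unique xs →
              All (λ x → x ∈ zs ⊎ f x ≈ 0#) xs → Σ f xs ≤ Σ f zs
  Σ-support {f = f} {zs} {xs} f-nonNeg xs! supp = begin
    Σ f xs                                               ≈⟨ Σ-cong (λ x → sym (*-identityˡ (f x))) xs ⟩
    Σ (λ x → 1# * f x) xs                                ≈⟨ Σ-map (λ (x , _) → 1# * f x) (_, tt) xs ⟨
    Σ (λ ((x , _) : _ × ⊤) → 1# * f x) (map (_, tt) xs)  ≤⟨ Σ-fibres (λ _ _ → 1#) f (λ _ → 1#) f-nonNeg unit-bound zs
                                                              (Unique.map⁺ (≡.cong proj₁) xs!) (All.map⁺ supp) ⟩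
    Σ (λ x → f x * 1#) zs                                ≈⟨ Σ-cong (λ x → *-identityʳ (f x)) zs ⟩
    Σ f zs                                               ∎
    where
    unit-bound : ∀ x {ys : List ⊤} → Unique ys → Σ (λ _ → 1#) ys ≤ 1#
    unit-bound x {[]}          _                = 0≤1
    unit-bound x {_ ∷ []}      _                = ≤-reflexive (+-identityʳ 1#)
    unit-bound x {_ ∷ _ ∷ _} ((tt≢tt ∷ _) ∷ _) = contradiction ≡.refl tt≢tt

  -- The list `zs` attains the supremum. The value `s` is the one supplied by completeness, so it
  -- agrees with the finite sum only up to `≈`.
  ∑∈-finite : ∀ {A : Set} {W : Pred A 0ℓ} {f : A → ℝ} {zs} → (∀ x → 0# ≤ f x) → Unique zs → All W zs →
              (∀ x → W x → x ∈ zs ⊎ f x ≈ 0#) → ∃[ s ] (∑∈ W f ≡ [ s ] × s ≈ Σ f zs)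
  ∑∈-finite {f = f} {zs} f-nonNeg zs! zs⊆W supp =
    let s , eq , upper , least = ⨆-finite _ (zs , zs! , zs⊆W) bound in
    s , eq , ≤-antisym (least bound) (upper (zs , zs! , zs⊆W))
    where
    bound : ∀ ((xs , _) : Σ[ xs ∈ List _ ] (Unique xs × All _ xs)) → Σ f xs ≤ Σ f zs
    bound (xs , xs! , xs⊆W) = Σ-support f-nonNeg xs! (All.map (supp _) xs⊆W)

  enumerate : ∀ {A : Set} {W : Pred A 0ℓ} → IsFinite W → ∃[ zs ] (Unique zs × All W zs × (∀ x → W x → x ∈ zs))
  enumerate {A} {W} (xs , covers) =
    deduplicate _≟_ (filter W? xs) , UniqueDec.deduplicate-! _≟_ (filter W? xs) ,
    All.tabulate (λ x∈ → proj₂ (∈-filter⁻ W? {xs = xs} (∈-deduplicate⁻ _≟_ (filter W? xs) x∈))) ,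
    λ x Wx → ∈-deduplicate⁺ _≟_ (∈-filter⁺ W? (covers x Wx) Wx)
    where
    _≟_ : DecidableEquality A
    x ≟ y = em
    W? : ∀ x → Dec (W x)
    W? x = em

  -- The test functions

  ÷-least : ∀ {x y c} → 0# < c → x ≤± [ y * c ] → x ÷ c ≤± [ y ]
  ÷-least {⊥±}    0<c h = ⊥±≤ _
  ÷-least {[ x ]} 0<c h = []-mono (/≤⇐≤* 0<c ([≤]-injective h))
  ÷-least {⊤±}    0<c h = contradiction h ⊤±≰[]

  Σ-≤ : ∀ {A : Set} {f : A → ℝ} {u} → ∑ f ≤± [ u ] → ∀ {xs} → Unique xs → Σ f xs ≤ u
  Σ-≤ h {xs} xs! = [≤]-injective (≤±-trans (⨆-upper _ (xs , xs! , All.universal (λ _ → tt) xs)) h)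

  ∑-least : ∀ {A : Set} {f : A → ℝ} {u} → (∀ {xs} → Unique xs → Σ f xs ≤ u) → ∑ f ≤± [ u ]
  ∑-least h = ⨆-least _ λ (xs , xs! , _) → []-mono (h xs!)

  module TestFunction
    {X : Set} (G : Graph X) {p : ℝ} (1≤p : 1# ≤ p)
    {d : X → X → ℝ} (isPseudoMetric : IsPseudoMetric d)
    (intrinsic : ∀ x → ∑ (λ y → Graph.b G x y * d x y ^ p) ≤± [ Graph.m G x ])
    (o : X) {r a : ℝ} (0<a : 0# < a)
    {zs : List X} (zs! : Unique zs) (zs⊆ball : All (Ball d o r) zs) (ball⊆zs : ∀ x → Ball d o r x → x ∈ zs)
    where

    open Graph G
    open IsPseudoMetric isPseudoMetric renaming (sym to d-sym)
    open IsPreMetric isPreMetric using (nonNegative; ≈⇒0)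

    0≤p : 0# ≤ p
    0≤p = ≤-trans 0≤1 1≤p

    depth : X → ℝ
    depth x = (r - d o x) ⊔ 0#

    depth-nonNeg : ∀ x → 0# ≤ depth x
    depth-nonNeg x = x≤y⊔x _ 0#

    depth-outside : ∀ {x} → r < d o x → depth x ≈ 0#
    depth-outside {x} out = ≤-antisym (⊔-lub (≤-cert (d o x - r)
      (solve 2 (λ r s → con (+ 0) :- (r :- s) := s :- r) refl r (d o x)) (0≤y-x (<⇒≤ out))) ≤-refl) (depth-nonNeg x)

    depth-≤ : ∀ x y → depth x - depth y ≤ d x y
    depth-≤ x y = ≤-cert (depth y + d x y - depth x)
      (solve 3 (λ u v t → t :- (u :- v) := v :+ t :- u) refl (depth x) (depth y) (d x y))
      (0≤y-x (⊔-lub (≤-cert ((depth y - (r - d o y)) + (d o x + d x y - d o y))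
        (solve 5 (λ v t r s q → v :+ t :- (r :- s) := (v :- (r :- q)) :+ (s :+ t :- q)) refl (depth y) (d x y) r (d o x) (d o y))
        (+-nonNeg (0≤y-x (x≤x⊔y _ 0#)) (0≤y-x (triangle o x y)))) (+-nonNeg (depth-nonNeg y) nonNegative)))

    exponent-Lipschitz : ∀ x y → ∣ a * depth x - a * depth y ∣ ≤ a * d x y
    exponent-Lipschitz x y = ∣∣-least (bound x y) (begin
      - (a * depth x - a * depth y)   ≈⟨ solve 3 (λ a u v → :- (a :* u :- a :* v) := a :* v :- a :* u) refl a (depth x) (depth y) ⟩
      a * depth y - a * depth x       ≤⟨ bound y x ⟩
      a * d y x                       ≈⟨ *-congˡ (d-sym y x) ⟩
      a * d x y                       ∎)
      where
      bound : ∀ x y → a * depth x - a * depth y ≤ a * d x y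
      bound x y = begin
        a * depth x - a * depth y   ≈⟨ solve 3 (λ a u v → a :* u :- a :* v := a :* (u :- v)) refl a (depth x) (depth y) ⟩
        a * (depth x - depth y)     ≤⟨ *-monoʳ-≤ (<⇒≤ 0<a) (depth-≤ x y) ⟩
        a * d x y                   ∎

    e φ : X → ℝ
    e x = exp (a * depth x)
    φ x = e x - 1#

    e-pos : ∀ x → 0# < e x
    e-pos x = exp-pos _

    φ-nonNeg : ∀ x → 0# ≤ φ x
    φ-nonNeg x = begin
      0#                          ≤⟨ *-nonNeg (<⇒≤ 0<a) (depth-nonNeg x) ⟩
      a * depth x                 ≤⟨ ≤-cert (e x - (1# + a * depth x))
                                       (solve 2 (λ e t → e :- con (+ 1) :- t := e :- (con (+ 1) :+ t)) refl (e x) (a * depth x))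
                                       (0≤y-x (1+x≤exp _)) ⟩
      φ x                         ∎

    e-outside : ∀ {x} → r < d o x → e x ≈ 1#
    e-outside out = ≤-antisym (exp0≤1 eq)
      (≤-trans (≤-reflexive (sym (trans (+-congˡ eq) (+-identityʳ 1#)))) (1+x≤exp _))
      where eq = trans (*-congˡ (depth-outside out)) (zeroʳ a)

    φ-outside : ∀ {x} → r < d o x → φ x ≈ 0#
    φ-outside out = trans (+-congʳ (e-outside out)) (-‿inverseʳ 1#)

    1^p≈1 : 1# ^ p ≈ 1#
    1^p≈1 = begin-equality
      1# ^ p            ≈⟨ ^-cong p exp0≈1 ⟨
      exp 0# ^ p        ≈⟨ exp-^ 0# p ⟩
      exp (p * 0#)      ≈⟨ exp-cong (zeroʳ p) ⟩
      exp 0#            ≈⟨ exp0≈1 ⟩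
      1#                ∎
      where
      exp0≈1 : exp 0# ≈ 1#
      exp0≈1 = ≤-antisym (exp0≤1 refl) (≤-trans (≤-reflexive (sym (+-identityʳ 1#))) (1+x≤exp 0#))

    -- The summand 1 accounts for the edges leaving the ball, whose outer end has e = 1.
    g : X → ℝ
    g x with em {Ball d o r x}
    ... | yes _ = e x ^ p + 1#
    ... | no  _ = 0#

    g-inside : ∀ {x} → d o x ≤ r → g x ≈ e x ^ p + 1#
    g-inside {x} in-ball with em {Ball d o r x}
    ... | yes _   = refl
    ... | no  out = contradiction in-ball out

    g-outside : ∀ {x} → r < d o x → g x ≈ 0#
    g-outside {x} out with em {Ball d o r x}
    ... | yes in-ball = contradiction in-ball (<⇒≱ out)
    ... | no  _       = refl

    e^p-nonNeg : ∀ x → 0# ≤ e x ^ p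
    e^p-nonNeg x = ^-nonNeg _ p

    g-nonNeg : ∀ x → 0# ≤ g x
    g-nonNeg x with <-total r (d o x)
    ... | inj₁ out     = ≤-reflexive (sym (g-outside out))
    ... | inj₂ in-ball = ≤-trans (+-nonNeg (e^p-nonNeg x) 0≤1) (≤-reflexive (sym (g-inside in-ball)))

    support : ∀ {f : X → ℝ} → (∀ {x} → r < d o x → f x ≈ 0#) → ∀ x → x ∈ zs ⊎ f x ≈ 0#
    support f-outside x with <-total r (d o x)
    ... | inj₁ out     = inj₂ (f-outside out)
    ... | inj₂ in-ball = inj₁ (ball⊆zs x in-ball)

    difference-^ : ∀ x y → 2# * ∣ φ x - φ y ∣ ^ p ≤ (a ^ p * d x y ^ p) * (e x ^ p + e y ^ p)
    difference-^ x y = begin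
      2# * ∣ φ x - φ y ∣ ^ p                   ≈⟨ *-congˡ (^-cong p (∣∣-cong (solve 2 (λ a b → a :- con (+ 1) :- (b :- con (+ 1)) := a :- b) refl (e x) (e y)))) ⟩
      2# * ∣ e x - e y ∣ ^ p                   ≤⟨ exp-difference-^ 1≤p (exponent-Lipschitz x y) ⟩
      (e x ^ p + e y ^ p) * (a * d x y) ^ p    ≈⟨ *-congˡ (*-^ p (<⇒≤ 0<a) nonNegative) ⟩
      (e x ^ p + e y ^ p) * (a ^ p * d x y ^ p) ≈⟨ *-comm _ _ ⟩
      (a ^ p * d x y ^ p) * (e x ^ p + e y ^ p) ∎

    -- Passing from `e x ^ p` to `g x` makes the weight finitely supported. If both ends lie outside
    -- the ball, the weight is 0, but so is the difference of `φ`, and a power with base 0 is 0.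
    difference-^-g : ∀ x y → 2# * ∣ φ x - φ y ∣ ^ p ≤ (a ^ p * d x y ^ p) * (g x + g y)
    difference-^-g x y = cases (<-total r (d o x)) (<-total r (d o y))
      where
      ad = *-nonNeg (^-nonNeg a p) (^-nonNeg (d x y) p)
      e^p≤g : ∀ {x} → d o x ≤ r → e x ^ p ≤ g x
      e^p≤g {x} in-ball = ≤-trans (≤-cert 1# (solve 1 (λ t → t :+ con (+ 1) :- t := con (+ 1)) refl (e x ^ p)) 0≤1)
        (≤-reflexive (sym (g-inside in-ball)))
      e^p-outside : ∀ {x} → r < d o x → e x ^ p ≈ 1#
      e^p-outside out = trans (^-cong p (e-outside out)) 1^p≈1
      mixed : ∀ {x y} → d o x ≤ r → r < d o y → e x ^ p + e y ^ p ≈ g x + g y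
      mixed {x} {y} in-ball out = begin-equality
        e x ^ p + e y ^ p   ≈⟨ +-congˡ (e^p-outside out) ⟩
        e x ^ p + 1#        ≈⟨ g-inside in-ball ⟨
        g x                 ≈⟨ +-identityʳ (g x) ⟨
        g x + 0#            ≈⟨ +-congˡ (g-outside out) ⟨
        g x + g y           ∎
      cases : r < d o x ⊎ d o x ≤ r → r < d o y ⊎ d o y ≤ r → 2# * ∣ φ x - φ y ∣ ^ p ≤ (a ^ p * d x y ^ p) * (g x + g y)
      cases (inj₂ x-in)  (inj₂ y-in)  = ≤-trans (difference-^ x y) (*-monoʳ-≤ ad (+-mono-≤ (e^p≤g x-in) (e^p≤g y-in)))
      cases (inj₂ x-in)  (inj₁ y-out) = ≤-trans (difference-^ x y) (*-monoʳ-≤ ad (≤-reflexive (mixed x-in y-out)))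
      cases (inj₁ x-out) (inj₂ y-in)  = ≤-trans (difference-^ x y) (*-monoʳ-≤ ad (≤-reflexive
        (trans (+-comm _ _) (trans (mixed y-in x-out) (+-comm _ _)))))
      cases (inj₁ x-out) (inj₁ y-out) = begin
        2# * ∣ φ x - φ y ∣ ^ p                    ≈⟨ *-congˡ (^-of-nonPos p (≤-reflexive (trans (∣∣-cong
                                                       (trans (+-cong (φ-outside x-out) (-‿cong (φ-outside y-out))) (-‿inverseʳ 0#)))
                                                       (∣∣-of-nonNeg ≤-refl)))) ⟩
        2# * 0#                                   ≈⟨ zeroʳ 2# ⟩
        0#                                        ≤⟨ *-nonNeg ad (+-nonNeg (g-nonNeg x) (g-nonNeg y)) ⟩
        (a ^ p * d x y ^ p) * (g x + g y)         ∎

    k : X → X → ℝ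
    k x y = b x y * d x y ^ p

    -- The list `ps` need not be symmetric, so the terms weighted at the second endpoint are
    -- rewritten as terms weighted at the first over the swapped list. The condition on `d` bounds
    -- each of the two sums by `S`, and the resulting factor 2 cancels the one in `difference-^-g`.
    Σ-edges-≤ : ∀ {ps} → Unique ps → Σ (λ (x , y) → b x y * ∣ φ x - φ y ∣ ^ p) ps ≤ a ^ p * Σ (λ z → g z * m z) zs
    Σ-edges-≤ {ps} ps! = *-cancelʳ-≤ 0<2 (begin
      Σ edge ps * 2#                                            ≈⟨ *-comm _ 2# ⟩
      2# * Σ edge ps                                            ≈⟨ Σ-*ˡ 2# edge ps ⟨
      Σ (λ q → 2# * edge q) ps                                  ≤⟨ Σ-mono (λ (x , y) → edge-≤ x y) ps ⟩
      Σ (λ q → a ^ p * (source q + target q)) ps                ≈⟨ Σ-*ˡ (a ^ p) _ ps ⟩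
      a ^ p * Σ (λ q → source q + target q) ps                  ≈⟨ *-congˡ (Σ-+ source target ps) ⟩
      a ^ p * (Σ source ps + Σ target ps)                       ≈⟨ *-congˡ (+-congˡ (trans (Σ-cong target≈ ps) (sym (Σ-map source swap ps)))) ⟩
      a ^ p * (Σ source ps + Σ source (map swap ps))            ≤⟨ *-monoʳ-≤ (^-nonNeg a p) (+-mono-≤ (Σ-source ps!)
                                                                     (Σ-source (Unique.map⁺ (≡.cong swap) ps!))) ⟩
      a ^ p * (S + S)                                           ≈⟨ solve 2 (λ c s → c :* (s :+ s) := c :* s :* con (+ 2)) refl (a ^ p) S ⟩
      a ^ p * S * 2#                                            ∎)
      where
      S = Σ (λ z → g z * m z) zs
      edge source target : X × X → ℝ
      edge (x , y)   = b x y * ∣ φ x - φ y ∣ ^ p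
      source (x , y) = k x y * g x
      target (x , y) = k x y * g y
      target≈ : ∀ q → target q ≈ source (swap q)
      target≈ (x , y) = *-congʳ (*-cong (b-sym x y) (^-cong p (d-sym x y)))
      Σ-source : ∀ {ps} → Unique ps → Σ source ps ≤ S
      Σ-source {ps} ps! = Σ-fibres k g m g-nonNeg (λ x → Σ-≤ (intrinsic x)) zs ps!
        (All.universal (λ (x , _) → support g-outside x) ps)
      edge-≤ : ∀ x y → 2# * edge (x , y) ≤ a ^ p * (source (x , y) + target (x , y))
      edge-≤ x y = begin
        2# * (b x y * ∣ φ x - φ y ∣ ^ p)                  ≈⟨ solve 3 (λ t b u → t :* (b :* u) := b :* (t :* u)) refl 2# (b x y) _ ⟩
        b x y * (2# * ∣ φ x - φ y ∣ ^ p)                  ≤⟨ *-monoʳ-≤ (b-nonNeg x y) (difference-^-g x y) ⟩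
        b x y * (a ^ p * d x y ^ p * (g x + g y))         ≈⟨ solve 5 (λ b a d g h → b :* (a :* d :* (g :+ h)) := a :* (b :* d :* g :+ b :* d :* h)) refl
                                                               (b x y) (a ^ p) (d x y ^ p) (g x) (g y) ⟩
        a ^ p * (k x y * g x + k x y * g y)               ∎

    N V : ℝ
    N = Σ (λ x → ∣ φ x ∣ ^ p * m x) zs
    V = Σ m zs

    m-nonNeg : ∀ x → 0# ≤ m x
    m-nonNeg x = <⇒≤ (m-pos x)

    ∣φ∣^p*m-nonNeg : ∀ x → 0# ≤ ∣ φ x ∣ ^ p * m x
    ∣φ∣^p*m-nonNeg x = *-nonNeg (^-nonNeg _ p) (m-nonNeg x)

    ∣φ∣^p*m-zero : ∀ {x} → φ x ≈ 0# → ∣ φ x ∣ ^ p * m x ≈ 0#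
    ∣φ∣^p*m-zero φx≈0 = trans (*-congʳ (^-of-nonPos p (≤-reflexive (trans (∣∣-cong φx≈0) (∣∣-of-nonNeg ≤-refl))))) (zeroˡ _)

    -- Positivity of `N` serves three times: `φ` is nonzero, the norm is a positive divisor, and the
    -- root taken in the norm is undone by the power. The factor `2#` comes from the half in the
    -- energy.
    λ⁽⁰⁾-≤ : ∀ {w} → 0# < N → a ^ p * Σ (λ z → g z * m z) zs ≤ w * 2# * N → λ⁽⁰⁾ p ≤± [ w ]
    λ⁽⁰⁾-≤ {w} 0<N h = ≤±-trans (⨅-lower _ (φ , finitelySupported , nonZero))
      (÷-least (^-pos p 0<norm) (÷-least 0<2 (∑-least λ {ps} ps! → begin
        Σ (λ (x , y) → b x y * ∣ φ x - φ y ∣ ^ p) ps       ≤⟨ Σ-edges-≤ ps! ⟩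
        a ^ p * Σ (λ z → g z * m z) zs                     ≤⟨ h ⟩
        w * 2# * N                                         ≈⟨ *-congˡ norm^p≈N ⟨
        w * 2# * real (norm p φ) ^ p                       ≈⟨ solve 3 (λ w t n → w :* t :* n := w :* n :* t) refl w 2# _ ⟩
        w * real (norm p φ) ^ p * 2#                       ∎)))
      where
      finitelySupported : FinitelySupported φ
      finitelySupported = zs , λ x φx≉0 → [ (λ x∈zs → x∈zs) , (λ φx≈0 → contradiction φx≈0 φx≉0) ]′ (support φ-outside x)
      nonZero : NonZero φ
      nonZero φ≈0 = >⇒≉ 0<N (Σ-zero (All.universal (λ x → ∣φ∣^p*m-zero (φ≈0 x)) zs))
      0<p : 0# < p
      0<p = <-≤-trans 0<1 1≤p
      N-sum = ∑∈-finite {W = U} ∣φ∣^p*m-nonNeg zs! (All.universal (λ _ → tt) zs)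
        λ x _ → support (λ out → ∣φ∣^p*m-zero (φ-outside out)) x
      n = proj₁ N-sum
      n≈N : n ≈ N
      n≈N = proj₂ (proj₂ N-sum)
      0<n : 0# < n
      0<n = <-respʳ-≈ (sym n≈N) 0<N
      norm≡ : real (norm p φ) ≡ n ^ (1# / p)
      norm≡ = ≡.cong (λ t → real (t ^± (1# / p))) (proj₁ (proj₂ N-sum))
      0<norm : 0# < real (norm p φ)
      0<norm = <-respʳ-≈ (reflexive (≡.sym norm≡)) (^-pos (1# / p) 0<n)
      norm^p≈N : real (norm p φ) ^ p ≈ N
      norm^p≈N = trans (^-cong p (reflexive norm≡)) (trans (^-root 0<n 0<p) n≈N)

    module Estimates {a′ : ℝ} (a<a′ : a < a′) where

      -- `C` is the threshold from which `a * e x ≤ a′ * (e x - 1#)` holds. `D` bounds `a ^ p * g x`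
      -- at the points of the ball below the threshold.
      C D : ℝ
      C = a′ / (a′ - a)
      D = a ^ p * (C ^ p + 1#)

      0<a′ : 0# < a′
      0<a′ = <-trans 0<a a<a′

      D-nonNeg : 0# ≤ D
      D-nonNeg = *-nonNeg (^-nonNeg a p) (+-nonNeg (^-nonNeg C p) 0≤1)

      e-≤-φ : ∀ {x} → C ≤ e x → (a * e x) ^ p ≤ a′ ^ p * ∣ φ x ∣ ^ p
      e-≤-φ {x} C≤e = begin
        (a * e x) ^ p            ≤⟨ ^-mono-≤ 0≤p (≤-cert (e x * (a′ - a) - a′)
            (solve 3 (λ a a′ e → a′ :* (e :- con (+ 1)) :- a :* e := e :* (a′ :- a) :- a′) refl a a′ (e x))
            (0≤y-x (≤-trans (≤-reflexive (sym (/-*-cancel a′ (0<y-x a<a′)))) (*-monoˡ-≤ (<⇒≤ (0<y-x a<a′)) C≤e)))) ⟩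
        (a′ * φ x) ^ p           ≈⟨ *-^ p (<⇒≤ 0<a′) (φ-nonNeg x) ⟩
        a′ ^ p * φ x ^ p         ≈⟨ *-congˡ (^-cong p (∣∣-of-nonNeg (φ-nonNeg x))) ⟨
        a′ ^ p * ∣ φ x ∣ ^ p     ∎

      -- Below the threshold `D` alone suffices. Above it `e-≤-φ` handles the power of `e x`, and
      -- the summand `a ^ p` left over from `g` fits into `D` as `C ^ p` is nonnegative.
      a^p*g-≤ : ∀ x → a ^ p * g x ≤ a′ ^ p * ∣ φ x ∣ ^ p + D
      a^p*g-≤ x with <-total r (d o x) | <-total (e x) C
      ... | inj₁ out | _ = begin
        a ^ p * g x                    ≈⟨ *-congˡ (g-outside out) ⟩
        a ^ p * 0#                     ≈⟨ zeroʳ _ ⟩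
        0#                             ≤⟨ +-nonNeg (*-nonNeg (^-nonNeg a′ p) (^-nonNeg _ p)) D-nonNeg ⟩
        a′ ^ p * ∣ φ x ∣ ^ p + D       ∎
      ... | inj₂ in-ball | inj₁ e<C = begin
        a ^ p * g x                    ≈⟨ *-congˡ (g-inside in-ball) ⟩
        a ^ p * (e x ^ p + 1#)         ≤⟨ *-monoʳ-≤ (^-nonNeg a p) (+-mono-≤ (^-mono-≤ 0≤p (<⇒≤ e<C)) ≤-refl) ⟩
        D                              ≈⟨ +-identityˡ D ⟨
        0# + D                         ≤⟨ +-mono-≤ (*-nonNeg (^-nonNeg a′ p) (^-nonNeg _ p)) ≤-refl ⟩
        a′ ^ p * ∣ φ x ∣ ^ p + D       ∎
      ... | inj₂ in-ball | inj₂ C≤e = begin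
        a ^ p * g x                    ≈⟨ *-congˡ (g-inside in-ball) ⟩
        a ^ p * (e x ^ p + 1#)         ≈⟨ distribˡ _ _ _ ⟩
        a ^ p * e x ^ p + a ^ p * 1#   ≈⟨ +-congʳ (*-^ p (<⇒≤ 0<a) (<⇒≤ (e-pos x))) ⟨
        (a * e x) ^ p + a ^ p * 1#     ≤⟨ +-mono-≤ (e-≤-φ C≤e) (*-monoʳ-≤ (^-nonNeg a p)
                                            (≤-cert (C ^ p) (solve 1 (λ c → c :+ con (+ 1) :- con (+ 1) := c) refl (C ^ p)) (^-nonNeg C p))) ⟩
        a′ ^ p * ∣ φ x ∣ ^ p + D       ∎

      a^p*Σgm-≤ : a ^ p * Σ (λ z → g z * m z) zs ≤ a′ ^ p * N + D * V
      a^p*Σgm-≤ = begin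
        a ^ p * Σ (λ z → g z * m z) zs                                      ≈⟨ Σ-*ˡ (a ^ p) _ zs ⟨
        Σ (λ z → a ^ p * (g z * m z)) zs                                    ≤⟨ Σ-mono pointwise zs ⟩
        Σ (λ z → a′ ^ p * (∣ φ z ∣ ^ p * m z) + D * m z) zs                 ≈⟨ Σ-+ _ _ zs ⟩
        Σ (λ z → a′ ^ p * (∣ φ z ∣ ^ p * m z)) zs + Σ (λ z → D * m z) zs    ≈⟨ +-cong (Σ-*ˡ (a′ ^ p) _ zs) (Σ-*ˡ D m zs) ⟩
        a′ ^ p * N + D * V                                                  ∎
        where
        pointwise : ∀ z → a ^ p * (g z * m z) ≤ a′ ^ p * (∣ φ z ∣ ^ p * m z) + D * m z
        pointwise z = begin
          a ^ p * (g z * m z)                             ≈⟨ *-assoc _ _ _ ⟨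
          a ^ p * g z * m z                               ≤⟨ *-monoˡ-≤ (m-nonNeg z) (a^p*g-≤ z) ⟩
          (a′ ^ p * ∣ φ z ∣ ^ p + D) * m z                ≈⟨ solve 4 (λ a f d m → (a :* f :+ d) :* m := a :* (f :* m) :+ d :* m) refl (a′ ^ p) (∣ φ z ∣ ^ p) D (m z) ⟩
          a′ ^ p * (∣ φ z ∣ ^ p * m z) + D * m z          ∎

      -- By definition the depth is at least `r - 1#` on the unit ball. The exponential is at least
      -- `C` there, so `e-≤-φ` applies, and the subtracted 1 in `φ` needs no further estimate.
      N-≥ : ∀ {ys} → Unique ys → All (Ball d o 1#) ys → 1# ≤ r → C ≤ exp (a * (r - 1#)) →
            (a * exp (a * (r - 1#))) ^ p * Σ m ys ≤ a′ ^ p * N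
      N-≥ {ys} ys! ys⊆ball 1≤r C≤E = begin
        (a * E) ^ p * Σ m ys                          ≈⟨ Σ-*ˡ ((a * E) ^ p) m ys ⟨
        Σ (λ y → (a * E) ^ p * m y) ys                ≤⟨ Σ-mono-All (All.map pointwise ys⊆ball) ⟩
        Σ (λ y → a′ ^ p * (∣ φ y ∣ ^ p * m y)) ys     ≈⟨ Σ-*ˡ (a′ ^ p) _ ys ⟩
        a′ ^ p * Σ (λ y → ∣ φ y ∣ ^ p * m y) ys       ≤⟨ *-monoʳ-≤ (^-nonNeg a′ p) (Σ-support ∣φ∣^p*m-nonNeg ys!
                                                           (All.map (λ y-in → inj₁ (ball⊆zs _ (≤-trans y-in 1≤r))) ys⊆ball)) ⟩
        a′ ^ p * N                                    ∎
        where
        E = exp (a * (r - 1#))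
        pointwise : ∀ {y} → Ball d o 1# y → (a * E) ^ p * m y ≤ a′ ^ p * (∣ φ y ∣ ^ p * m y)
        pointwise {y} y-in = begin
          (a * E) ^ p * m y                     ≤⟨ *-monoˡ-≤ (m-nonNeg y) (^-mono-≤ 0≤p (*-monoʳ-≤ (<⇒≤ 0<a) E≤e)) ⟩
          (a * e y) ^ p * m y                   ≤⟨ *-monoˡ-≤ (m-nonNeg y) (e-≤-φ (≤-trans C≤E E≤e)) ⟩
          a′ ^ p * ∣ φ y ∣ ^ p * m y            ≈⟨ *-assoc _ _ _ ⟩
          a′ ^ p * (∣ φ y ∣ ^ p * m y)          ∎
          where
          E≤e : E ≤ e y
          E≤e = exp-mono-≤ (*-monoʳ-≤ (<⇒≤ 0<a) (begin
            r - 1#       ≤⟨ +-mono-≤ ≤-refl (neg-mono-≤ y-in) ⟩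
            r - d o y    ≤⟨ x≤x⊔y _ 0# ⟩
            depth y      ∎))

  -- From the volume growth to the bound on `λ⁽⁰⁾`.

  ≤±-dense : ∀ {x z} → (∀ {w} → z < w → x ≤± [ w ]) → x ≤± [ z ]
  ≤±-dense {⊥±}    {z} h = ⊥±≤ _
  ≤±-dense {[ x ]} {z} h = []-mono (≤-by-contra λ z<x → let w , z<w , w<x = <-dense z<x in
    <⇒≱ w<x ([≤]-injective (h z<w)))
  ≤±-dense {⊤±}    {z} h = contradiction (h (<-cert 1# (solve 1 (λ z → z :+ con (+ 1) :- z := con (+ 1)) refl z) 0<1)) ⊤±≰[]

  module UpperBound
    {X : Set} (G : Graph X) {p : ℝ} (1≤p : 1# ≤ p)
    {d : X → X → ℝ} (isPseudoMetric : IsPseudoMetric d)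
    (balls-finite : ∀ o r → 0# ≤ r → IsFinite (Ball d o r))
    (intrinsic : ∀ x → ∑ (λ y → Graph.b G x y * d x y ^ p) ≤± [ Graph.m G x ])
    where

    open Graph G
    open IsPseudoMetric isPseudoMetric using (isPreMetric)
    open IsPreMetric isPreMetric using (≈⇒0)

    0<p : 0# < p
    0<p = <-≤-trans 0<1 1≤p

    vol : X → ℝ → ℝ
    vol o r = real (measure (Ball d o r))

    growthRate : X → ℝ → ℝ
    growthRate o r = 1# / r * log (vol o r / vol o 1#)

    m-nonNeg : ∀ x → 0# ≤ m x
    m-nonNeg x = <⇒≤ (m-pos x)

    vol≈Σ : ∀ {o r zs} → Unique zs → All (Ball d o r) zs → (∀ x → Ball d o r x → x ∈ zs) → vol o r ≈ Σ m zs
    vol≈Σ zs! zs⊆ ⊆zs = let s , eq , s≈ = ∑∈-finite m-nonNeg zs! zs⊆ (λ x x-in → inj₁ (⊆zs x x-in)) in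
      trans (reflexive (≡.cong real eq)) s≈

    vol-pos : ∀ {o r} → 0# ≤ r → 0# < vol o r
    vol-pos {o} {r} 0≤r = let zs , zs! , zs⊆ , ⊆zs = enumerate (balls-finite o r 0≤r) in
      <-respʳ-≈ (sym (vol≈Σ zs! zs⊆ ⊆zs))
        (<-≤-trans (m-pos o) (Σ-∈ m-nonNeg (⊆zs o (≤-trans (≤-reflexive (≈⇒0 ≡.refl)) 0≤r))))

    vol-mono : ∀ {o r s} → 0# ≤ r → r ≤ s → vol o r ≤ vol o s
    vol-mono {o} {r} {s} 0≤r r≤s =
      let zs , zs! , zs⊆ , ⊆zs = enumerate (balls-finite o r 0≤r)
          ys , ys! , ys⊆ , ⊆ys = enumerate (balls-finite o s (≤-trans 0≤r r≤s)) in begin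
      vol o r    ≈⟨ vol≈Σ zs! zs⊆ ⊆zs ⟩
      Σ m zs     ≤⟨ Σ-support m-nonNeg zs! (All.map (λ x-in → inj₁ (⊆ys _ (≤-trans x-in r≤s))) zs⊆) ⟩
      Σ m ys     ≈⟨ vol≈Σ ys! ys⊆ ⊆ys ⟨
      vol o s    ∎

    vol-≤-exp : ∀ {o r ν} → 0# < r → growthRate o r < ν → vol o r ≤ exp (ν * r) * vol o 1#
    vol-≤-exp {o} {r} {ν} 0<r rate<ν = begin
      vol o r                          ≈⟨ /-*-cancel _ 0<vol₁ ⟨
      q * vol o 1#                     ≤⟨ *-monoˡ-≤ (<⇒≤ 0<vol₁) (begin
          q                                ≈⟨ exp-log 0<q ⟨
          exp (log q)                      ≈⟨ exp-cong (/-*-cancel (log q) 0<r) ⟨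
          exp (log q / r * r)              ≤⟨ exp-mono-≤ (*-monoˡ-≤ (<⇒≤ 0<r) (≤-trans (≤-reflexive
                                                (solve 2 (λ l i → l :* i := con (+ 1) :* i :* l) refl (log q) (r ⁻¹))) (<⇒≤ rate<ν))) ⟩
          exp (ν * r)                      ∎) ⟩
      exp (ν * r) * vol o 1#           ∎
      where
      0<vol₁ = vol-pos 0≤1
      q = vol o r / vol o 1#
      0<q = /-pos (vol-pos (<⇒≤ 0<r)) 0<vol₁

    -- The form in which the limit inferior is used: slow growth at arbitrarily large radii, with a
    -- centre that may depend on the radius.
    GrowsSlowerThan : ℝ → Set
    GrowsSlowerThan ν = ∀ s → ∃[ r ] (s ≤ r × ∃[ o ] growthRate o r < ν)

    -- If no radius beyond `s` had a centre with rate below `ν`, the infimum over that tail, and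
    -- with it the limit inferior, would be at least `ν`.
    volumeGrowth-< : ∀ {μ ν} → volumeGrowth d ≤± [ μ ] → μ < ν → GrowsSlowerThan ν
    volumeGrowth-< {μ} {ν} growth≤μ μ<ν s with em {∃[ r ] (s ≤ r × ∃[ o ] growthRate o r < ν)}
    ... | yes found = found
    ... | no  none  = contradiction ([≤]-injective (≤±-trans
        (⨅-greatest _ λ (r , s≤r) → ⨅-greatest _ λ o → []-mono (≤-by-contra λ rate<ν → none (r , s≤r , o , rate<ν)))
        (≤±-trans (⨆-upper _ s) growth≤μ)))
      (<⇒≱ μ<ν)

    -- A growth of minus infinity would produce a radius `r ≥ 1#` with a rate below -1, hence a ball
    -- smaller in measure than the unit ball that it contains.
    volumeGrowth≰⊥± : ¬ volumeGrowth d ≤± ⊥±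
    volumeGrowth≰⊥± growth≤⊥ = let r , 1≤r , o , rate< = volumeGrowth-< (≤±-trans growth≤⊥ (⊥±≤ _)) -2<-1 1# in
      <⇒≱ (shrinks o (<-≤-trans 0<1 1≤r) rate<) (vol-mono 0≤1 1≤r)
      where
      -2<-1 : - 2# < - 1#
      -2<-1 = <-cert 1# (solve 0 (:- con (+ 1) :- :- con (+ 2) := con (+ 1)) refl) 0<1
      shrinks : ∀ {r} o → 0# < r → growthRate o r < - 1# → vol o r < vol o 1#
      shrinks {r} o 0<r rate< = begin-strict
        vol o r                       ≤⟨ vol-≤-exp 0<r rate< ⟩
        exp (- 1# * r) * vol o 1#     <⟨ *-monoˡ-< (vol-pos 0≤1) (<-≤-trans (exp-mono-< {y = 0#}
                                           (<-cert r (solve 1 (λ r → con (+ 0) :- :- con (+ 1) :* r := r) refl r) 0<r)) (exp0≤1 refl)) ⟩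
        1# * vol o 1#                 ≈⟨ *-identityˡ _ ⟩
        vol o 1#                      ∎

    module _ {a a′ c ν : ℝ} (0<a : 0# < a) (a<a′ : a < a′) (a′<c : a′ < c) (ν<pa : ν < p * a) where

      private
        0<a′ : 0# < a′
        0<a′ = <-trans 0<a a<a′
        0≤a^p = ^-nonNeg a p
        -- `η` is the surplus that must absorb the error term with factor `D`, and `Q` is the size
        -- that the exponential of `p * (a * (r - 1#)) - ν * r` needs for this. In `s₀` the summand
        -- `1# + C / a` ensures `C ≤ exp (a * (r - 1#))`; the last summand makes the other exponent,
        -- which equals `r * gap - p * a`, at least `Q`. Both use that `exp` dominates its argument.
        η C D Q gap s₀ : ℝ
        η = c ^ p - a′ ^ p
        C = a′ / (a′ - a)
        D = a ^ p * (C ^ p + 1#)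
        Q = D * a′ ^ p / (η * a ^ p)
        gap = p * a - ν
        s₀ = (1# + C / a) + (Q + p * a) / gap

        0<η : 0# < η
        0<η = 0<y-x (^-mono-< 0<p 0<a′ a′<c)
        0<ηa^p : 0# < η * a ^ p
        0<ηa^p = *-pos 0<η (^-pos p 0<a)
        0<gap : 0# < gap
        0<gap = 0<y-x ν<pa
        C-nonNeg : 0# ≤ C
        C-nonNeg = <⇒≤ (/-pos 0<a′ (0<y-x a<a′))
        D-nonNeg : 0# ≤ D
        D-nonNeg = *-nonNeg 0≤a^p (+-nonNeg (^-nonNeg C p) 0≤1)
        Q-nonNeg : 0# ≤ Q
        Q-nonNeg = /-nonNeg (*-nonNeg D-nonNeg (^-nonNeg a′ p)) 0<ηa^p
        0≤C/a : 0# ≤ C / a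
        0≤C/a = /-nonNeg C-nonNeg 0<a
        0≤last : 0# ≤ (Q + p * a) / gap
        0≤last = /-nonNeg (+-nonNeg Q-nonNeg (<⇒≤ (*-pos 0<p 0<a))) 0<gap

        module _ {r : ℝ} (s₀≤r : s₀ ≤ r) where

          1+C/a≤r : 1# + C / a ≤ r
          1+C/a≤r = ≤-trans (≤-cert _ (solve 2 (λ u v → u :+ v :- u := v) refl (1# + C / a) ((Q + p * a) / gap)) 0≤last) s₀≤r

          1≤r : 1# ≤ r
          1≤r = ≤-trans (≤-cert _ (solve 1 (λ u → con (+ 1) :+ u :- con (+ 1) := u) refl (C / a)) 0≤C/a) 1+C/a≤r

          C≤exp : C ≤ exp (a * (r - 1#))
          C≤exp = begin
            C                         ≈⟨ *-/-cancelˡ C 0<a ⟨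
            a * (C / a)               ≤⟨ *-monoʳ-≤ (<⇒≤ 0<a) (≤-cert _
                                           (solve 2 (λ r u → r :- con (+ 1) :- u := r :- (con (+ 1) :+ u)) refl r (C / a)) (0≤y-x 1+C/a≤r)) ⟩
            a * (r - 1#)              ≤⟨ ≤-cert 1# (solve 1 (λ u → con (+ 1) :+ u :- u := con (+ 1)) refl (a * (r - 1#))) 0≤1 ⟩
            1# + a * (r - 1#)         ≤⟨ 1+x≤exp _ ⟩
            exp (a * (r - 1#))        ∎

          Q≤exp : Q ≤ exp (p * (a * (r - 1#)) - ν * r)
          Q≤exp = begin
            Q                                    ≤⟨ ≤-cert (1# + (r * gap - (Q + p * a)))
                (solve 5 (λ q p a r ν → con (+ 1) :+ (p :* (a :* (r :- con (+ 1))) :- ν :* r) :- q := con (+ 1) :+ (r :* (p :* a :- ν) :- (q :+ p :* a)))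
                  refl Q p a r ν)
                (+-nonNeg 0≤1 (0≤y-x (≤-trans (≤-reflexive (sym (/-*-cancel (Q + p * a) 0<gap)))
                  (*-monoˡ-≤ (<⇒≤ 0<gap) (≤-trans (≤-cert (1# + C / a)
                    (solve 2 (λ u v → u :+ v :- v := u) refl (1# + C / a) ((Q + p * a) / gap)) (+-nonNeg 0≤1 0≤C/a)) s₀≤r))))) ⟩
            1# + (p * (a * (r - 1#)) - ν * r)    ≤⟨ 1+x≤exp _ ⟩
            exp (p * (a * (r - 1#)) - ν * r)     ∎

          -- What the absorption of the error term amounts to once both volumes are expressed by
          -- that of the unit ball; `Q` is chosen so that it reduces to `Q≤exp`.
          Da′^p≤ : D * a′ ^ p * exp (ν * r) ≤ η * (a * exp (a * (r - 1#))) ^ p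
          Da′^p≤ = begin
            D * a′ ^ p * exp (ν * r)                                         ≈⟨ *-congʳ (/-*-cancel _ 0<ηa^p) ⟨
            Q * (η * a ^ p) * exp (ν * r)                                    ≤⟨ *-monoˡ-≤ (<⇒≤ (exp-pos _)) (*-monoˡ-≤ (<⇒≤ 0<ηa^p) Q≤exp) ⟩
            exp (p * (a * (r - 1#)) - ν * r) * (η * a ^ p) * exp (ν * r)     ≈⟨ solve 4 (λ e h a f → e :* (h :* a) :* f := h :* (a :* (e :* f))) refl
                                                                                  _ η (a ^ p) _ ⟩
            η * (a ^ p * (exp (p * (a * (r - 1#)) - ν * r) * exp (ν * r)))   ≈⟨ *-congˡ (*-congˡ (exp-+ _ _)) ⟨
            η * (a ^ p * exp (p * (a * (r - 1#)) - ν * r + ν * r))           ≈⟨ *-congˡ (*-congˡ (exp-cong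
                                                                                  (solve 2 (λ u v → u :- v :+ v := u) refl (p * (a * (r - 1#))) (ν * r)))) ⟩
            η * (a ^ p * exp (p * (a * (r - 1#))))                           ≈⟨ *-congˡ (*-congˡ (exp-^ _ p)) ⟨
            η * (a ^ p * exp (a * (r - 1#)) ^ p)                             ≈⟨ *-congˡ (*-^ p (<⇒≤ 0<a) (<⇒≤ (exp-pos _))) ⟨
            η * (a * exp (a * (r - 1#))) ^ p                                 ∎

          λ⁽⁰⁾-≤-at : ∀ o → growthRate o r < ν → λ⁽⁰⁾ p ≤± [ c ^ p / 2# ]
          λ⁽⁰⁾-≤-at o rate<ν = T.λ⁽⁰⁾-≤ 0<N (begin
            a ^ p * Σ (λ z → T.g z * m z) zs     ≤⟨ Est.a^p*Σgm-≤ ⟩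
            a′ ^ p * T.N + D * T.V               ≤⟨ +-mono-≤ ≤-refl DV≤ηN ⟩
            a′ ^ p * T.N + η * T.N               ≈⟨ solve 3 (λ a c n → a :* n :+ (c :- a) :* n := c :* n) refl (a′ ^ p) (c ^ p) T.N ⟩
            c ^ p * T.N                          ≈⟨ *-congʳ (/-*-cancel _ 0<2) ⟨
            c ^ p / 2# * 2# * T.N                ∎)
            where
            0<r = <-≤-trans 0<1 1≤r
            ball = enumerate (balls-finite o r (<⇒≤ 0<r))
            zs = proj₁ ball
            unit-ball = enumerate (balls-finite o 1# 0≤1)
            ys = proj₁ unit-ball
            module T = TestFunction G 1≤p isPseudoMetric intrinsic o {r} 0<a
              (proj₁ (proj₂ ball)) (proj₁ (proj₂ (proj₂ ball))) (proj₂ (proj₂ (proj₂ ball)))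
            module Est = T.Estimates a<a′
            K M : ℝ
            K = (a * exp (a * (r - 1#))) ^ p
            M = Σ m ys
            vol₁≈M : vol o 1# ≈ M
            vol₁≈M = vol≈Σ (proj₁ (proj₂ unit-ball)) (proj₁ (proj₂ (proj₂ unit-ball))) (proj₂ (proj₂ (proj₂ unit-ball)))
            0<M : 0# < M
            0<M = <-respʳ-≈ vol₁≈M (vol-pos 0≤1)
            KM≤ : K * M ≤ a′ ^ p * T.N
            KM≤ = Est.N-≥ (proj₁ (proj₂ unit-ball)) (proj₁ (proj₂ (proj₂ unit-ball))) 1≤r C≤exp
            0<N : 0# < T.N
            0<N = ≰⇒> λ N≤0 → <⇒≱ (<-≤-trans (*-pos (^-pos p (*-pos 0<a (exp-pos _))) 0<M) KM≤)
              (≤-trans (*-monoʳ-≤ (^-nonNeg a′ p) N≤0) (≤-reflexive (zeroʳ _)))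
            V≤ : T.V ≤ exp (ν * r) * M
            V≤ = begin
              T.V                        ≈⟨ vol≈Σ (proj₁ (proj₂ ball)) (proj₁ (proj₂ (proj₂ ball))) (proj₂ (proj₂ (proj₂ ball))) ⟨
              vol o r                    ≤⟨ vol-≤-exp 0<r rate<ν ⟩
              exp (ν * r) * vol o 1#     ≈⟨ *-congˡ vol₁≈M ⟩
              exp (ν * r) * M            ∎
            -- Multiplication by `a′ ^ p` brings in `KM≤`, the lower bound for `a′ ^ p * T.N`.
            DV≤ηN : D * T.V ≤ η * T.N
            DV≤ηN = *-cancelʳ-≤ (^-pos p 0<a′) (begin
              D * T.V * a′ ^ p                    ≤⟨ *-monoˡ-≤ (^-nonNeg a′ p) (*-monoʳ-≤ D-nonNeg V≤) ⟩
              D * (exp (ν * r) * M) * a′ ^ p      ≈⟨ solve 4 (λ d e m a → d :* (e :* m) :* a := d :* a :* e :* m) refl D _ M _ ⟩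
              D * a′ ^ p * exp (ν * r) * M        ≤⟨ *-monoˡ-≤ (<⇒≤ 0<M) Da′^p≤ ⟩
              η * K * M                           ≈⟨ *-assoc η K M ⟩
              η * (K * M)                         ≤⟨ *-monoʳ-≤ (<⇒≤ 0<η) KM≤ ⟩
              η * (a′ ^ p * T.N)                  ≈⟨ solve 3 (λ h a n → h :* (a :* n) := h :* n :* a) refl η (a′ ^ p) T.N ⟩
              η * T.N * a′ ^ p                    ∎)

      λ⁽⁰⁾-≤-slow : GrowsSlowerThan ν → λ⁽⁰⁾ p ≤± [ c ^ p / 2# ]
      λ⁽⁰⁾-≤-slow slow = let r , s₀≤r , o , rate<ν = slow s₀ in λ⁽⁰⁾-≤-at s₀≤r o rate<ν

    -- The room below `p * c` is divided by `ν < ξ`, and `a = ξ / p` then satisfies both `ν < p * a`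
    -- and `a < c`. Starting from `μ ⊔ 0#` keeps `a` positive when `μ` is not.
    λ⁽⁰⁾-≤-growth : ∀ {μ c} → volumeGrowth d ≤± [ μ ] → 0# < c → μ < p * c → λ⁽⁰⁾ p ≤± [ c ^ p / 2# ]
    λ⁽⁰⁾-≤-growth {μ} {c} growth≤μ 0<c μ<pc =
      let ν , μ⁺<ν , ν<pc = <-dense μ⁺<pc
          ξ , ν<ξ , ξ<pc = <-dense ν<pc
          0<ξ = ≤-<-trans (x≤y⊔x μ 0#) (<-trans μ⁺<ν ν<ξ)
          ξ/p<c = <-respʳ-≈ (*-/-cancel c 0<p) (*-monoˡ-< (⁻¹-pos 0<p) (<-respʳ-≈ (*-comm p c) ξ<pc))
          a′ , a<a′ , a′<c = <-dense ξ/p<c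
      in λ⁽⁰⁾-≤-slow (/-pos 0<ξ 0<p) a<a′ a′<c (<-respʳ-≈ (sym (*-/-cancelˡ ξ 0<p)) ν<ξ)
           (volumeGrowth-< growth≤μ (≤-<-trans (x≤x⊔y μ 0#) μ⁺<ν))
      where
      μ⁺<pc : μ ⊔ 0# < p * c
      μ⁺<pc with ⊔-sel μ 0#
      ... | inj₁ eq = <-respˡ-≈ (sym eq) μ<pc
      ... | inj₂ eq = <-respˡ-≈ (sym eq) (*-pos 0<p 0<c)

    -- It suffices to reach every `w` above the right-hand side. The rate `c` is the solution of
    -- `c ^ p / 2# ≈ w`, and `p * c ≤ μ` would push `w` back down to the right-hand side.
    λ⁽⁰⁾-≤-finite : ∀ {μ} → volumeGrowth d ≤± [ μ ] → λ⁽⁰⁾ p ≤± [ μ ^ p / (2# * p ^ p) ]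
    λ⁽⁰⁾-≤-finite {μ} growth≤μ = ≤±-dense above
      where
      0<2p^p : 0# < 2# * p ^ p
      0<2p^p = *-pos 0<2 (^-pos p 0<p)
      above : ∀ {w} → μ ^ p / (2# * p ^ p) < w → λ⁽⁰⁾ p ≤± [ w ]
      above {w} <w = ≤±-trans (λ⁽⁰⁾-≤-growth growth≤μ 0<c μ<pc)
        ([]-mono (≤-trans (≤-reflexive (*-congʳ c^p≈)) (≤-reflexive (*-/-cancel w 0<2))))
        where
        0<w : 0# < w
        0<w = ≤-<-trans (/-nonNeg (^-nonNeg μ p) 0<2p^p) <w
        0<2w : 0# < w * 2#
        0<2w = *-pos 0<w 0<2
        c = (w * 2#) ^ (1# / p)
        0<c : 0# < c
        0<c = ^-pos _ 0<2w
        c^p≈ : c ^ p ≈ w * 2#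
        c^p≈ = ^-root 0<2w 0<p
        μ<pc : μ < p * c
        μ<pc = ≰⇒> λ pc≤μ → <⇒≱ <w (≤/⇐*≤ 0<2p^p (begin
          w * (2# * p ^ p)      ≈⟨ solve 3 (λ w t q → w :* (t :* q) := q :* (w :* t)) refl w 2# (p ^ p) ⟩
          p ^ p * (w * 2#)      ≈⟨ *-congˡ c^p≈ ⟨
          p ^ p * c ^ p         ≈⟨ *-^ p (<⇒≤ 0<p) (<⇒≤ 0<c) ⟨
          (p * c) ^ p           ≤⟨ ^-mono-≤ (<⇒≤ 0<p) pc≤μ ⟩
          μ ^ p                 ∎))

    -- The growth is generalised to `v` so that the extended power and quotient compute. The value
    -- `⊥±` has to be excluded because the right-hand side would then be `⊥±` as well.
    λ⁽⁰⁾-≤-volumeGrowth : ∀ v → volumeGrowth d ≡ v → λ⁽⁰⁾ p ≤± (v ^± p) ÷ (2# * p ^ p)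
    λ⁽⁰⁾-≤-volumeGrowth ⊥±    eq = contradiction (≡.subst (volumeGrowth d ≤±_) eq (≤±-refl _)) volumeGrowth≰⊥±
    λ⁽⁰⁾-≤-volumeGrowth [ μ ] eq = λ⁽⁰⁾-≤-finite (≡.subst (volumeGrowth d ≤±_) eq (≤±-refl _))
    λ⁽⁰⁾-≤-volumeGrowth ⊤±    eq = _ ≤⊤±

theorem4p1 : (em : ExcludedMiddle 0ℓ) (R : CompleteOrderedField) →
    let open Analysis em R in
    (X : Set) → X → X ↣ ℕ →
    (G : Graph X) →
    let open Graph G in
    (p : ℝ) → 1# ≤ p →
    (d : X → X → ℝ) → IsPseudoMetric d →
    (∀ o r → 0# ≤ r → IsFinite (Ball d o r)) →
    (∀ x → ∑ (λ y → b x y * d x y ^ p) ≤± [ m x ]) →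
    λ⁽⁰⁾ p ≤± (volumeGrowth d ^± p) ÷ (2# * p ^ p)
theorem4p1 em R X o X↣ℕ G p 1≤p d isPseudoMetric balls-finite intrinsic =
  λ⁽⁰⁾-≤-volumeGrowth _ ≡.refl
  where
  open RealAnalysis em R
  open UpperBound G 1≤p isPseudoMetric balls-finite intrinsic
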